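{- Let $q$ be an odd prime power, let $d$ be odd, let $i \in \{3,4\}$, let $P \subseteq \mathbb{F}_q^d$, and let $S$ be a set of $Q_i^d$-spheres all of radius zero. Then \[\left|I(P,S) - q^{ -1}|P|\,|S|\right| < \left((1+\sqrt{2})\,q^{d-1}|P|\,|S|\right)^{1/2}.\]
   Context: $\mathbb{F}_q$ is the finite field with $q$ elements. Fix a non-square $\epsilon\in\mathbb{F}_q$. For odd $d$, define quadratic forms on $\mathbb{F}_q^d$ by $Q_3^d(x) = x_1x_2 + x_3x_4 + \cdots + x_{d-2}x_{d-1} - x_d^2$ and $Q_4^d(x) = x_1x_2 + x_3x_4 + \cdots + x_{d-2}x_{d-1} - \epsilon x_d^2$. For a quadratic form $Q$, the $Q$-sphere with center $y$ and radius $r$ is $\{x \in \mathbb{F}_q^d : Q(x-y) = r\}$; a sphere is specified by its center and radius. For $P \subseteq \mathbb{F}_q^d$ and a set $S$ of spheres, $I(P,S) = \#\{(x,s) \in P \times S : x \in s\}$.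
   Formalization: P and S are assumed nonempty, because for empty P or empty S both sides are 0 and the strict inequality fails. -}

module Defs where

open import Level using (0ℓ)
open import Data.Nat as ℕ using (ℕ; zero; suc)
open import Data.Integer as ℤ using (ℤ; +_)
open import Data.Product using (_×_; _,_; proj₁; proj₂; ∃-syntax)
open import Data.Sum using (_⊎_)
open import Data.List using (List; length; filter; map)
open import Data.Nat.ListAction using (sum)
open import Data.List.Relation.Unary.Unique.Propositional using (Unique)
open import Data.List.Membership.Propositional using (_∈_)
open import Data.Vec using (Vec; []; _∷_; init; last; zipWith)
open import Relation.Binary.PropositionalEquality using (_≡_; _≢_)
open import Relation.Binary.Definitions using (DecidableEquality)
open import Algebra.Structures using (IsCommutativeRing)

record FiniteField : Set₁ where
  infixl 7 _*_
  infixl 6 _+_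
  field
    F : Set
    _+_ _*_ : F → F → F
    -_ : F → F
    0# 1# : F
    isCommutativeRing : IsCommutativeRing _≡_ _+_ _*_ -_ 0# 1#
    0≢1 : 0# ≢ 1#
    inv : (x : F) → x ≢ 0# → F
    inv-r : (x : F) (p : x ≢ 0#) → x * inv x p ≡ 1#
    _≟_ : DecidableEquality F
    elements : List F
    elements-unique : Unique elements
    elements-complete : (x : F) → x ∈ elements

  order : ℕ
  order = length elements

  _-_ : F → F → F
  x - y = x + (- y)

  IsSquare : F → Set
  IsSquare a = ∃[ b ] (b * b ≡ a)

  hyp : ∀ {n} → Vec F n → F
  hyp [] = 0#
  hyp (a ∷ []) = 0#
  hyp (a ∷ b ∷ v) = a * b + hyp v

  -- Q_c(x) = x₁x₂ + ⋯ + x_{d-2}x_{d-1} - c·x_d² ;  Q₃ is c = 1, Q₄ is c = ε.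
  Qform : ∀ {m} → F → Vec F (suc m) → F
  Qform c x = hyp (init x) - (c * (last x * last x))

  vsub : ∀ {n} → Vec F n → Vec F n → Vec F n
  vsub = zipWith _-_

  Sphere : ℕ → Set
  Sphere n = Vec F n × F

  incidences : ∀ {m} → F → List (Vec F (suc m)) → List (Sphere (suc m)) → ℕ
  incidences c P S =
    sum (map (λ x → length (filter (λ s → Qform c (vsub x (proj₁ s)) ≟ proj₂ s) S)) P)

-- Real-number-free encoding of  X < (1 + √2)·Y  for natural numbers X, Y:
-- either X < Y, or Y ≤ X and (X - Y)² < 2·Y²  (i.e. X - Y < √2·Y).
infix 4 _<[1+√2]·_
_<[1+√2]·_ : ℕ → ℕ → Set
X <[1+√2]· Y = (X ℕ.< Y) ⊎ ((Y ℕ.≤ X) × (((X ℕ.∸ Y) ℕ.* (X ℕ.∸ Y)) ℕ.< 2 ℕ.* (Y ℕ.* Y)))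

{-# OPTIONS --safe #-}

-- Let δ(a) = [a = 0], e = q δ - 1, and let B be the polar form of Q, so that q I(P,S) - |P||S|
-- is the sum of e(Q(x - y)) over x ∈ P and over the centres y ∈ C.  By Cauchy–Schwarz its square
-- is at most |P| times the sum over y, y′ ∈ C of the correlations
--   ∑ₓ e(Q(x - y)) e(Q(x - y′)) = q H(z, Q z),  z = y - y′,  H(z, t) = ∑ₓ δ(Q x) e(B(x, z) + t).
-- Since ∑ₜ H(z, t) = 0, H(z, ·) is constant off 0 by scaling, and H(z, ·) = 0 for isotropic z ≠ 0,
--   (q - 1)(q^d [z = 0] - H(z, Q z)) = H(z, 0).
-- For each x the kernel e(B(x, y) - B(x, y′)) is positive semidefinite, so the sum of H(y - y′, 0)
-- over y, y′ ∈ C is nonnegative.  This bounds the square of the discrepancy by q^{d+1}|P||S|, without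
-- characters and with constant 1 in place of 1 + √2.
module Submission where

open import Defs
open import Algebra.Bundles using (CommutativeRing)
import Algebra.Properties.Ring as RingProperties
import Algebra.Solver.Ring.NaturalCoefficients.Default as SemiringSolver
open import Data.Nat as ℕ using (ℕ; zero; suc; _%_; _^_)
import Data.Nat.Properties as ℕ
open import Data.Nat.ListAction using (sum)
open import Data.Integer as ℤ using (ℤ; +_; 0ℤ; 1ℤ; _+_; _*_; _-_; -_; _≤_)
import Data.Integer.Properties as ℤ
open import Data.Integer.Tactic.RingSolver using (solve-∀)
open import Data.Product using (_×_; _,_; proj₁; proj₂; ∃-syntax)
open import Data.Sum using (_⊎_; inj₁; inj₂; [_,_])
open import Data.List using (List; length; []; _∷_; _++_; map; filter; cartesianProductWith)
open import Data.List.Properties using (length-map)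
open import Data.List.Membership.Propositional using (_∈_)
open import Data.List.Membership.Propositional.Properties using (∈-cartesianProductWith⁺)
open import Data.List.Relation.Unary.Any using (here; there)
open import Data.List.Relation.Unary.Unique.Propositional using (Unique; []; _∷_)
open import Data.List.Relation.Unary.Unique.Propositional.Properties
  using (cartesianProductWith⁺; map⁻)
open import Data.List.Relation.Unary.All as All using (All; []; _∷_)
open import Data.Vec as Vec using (Vec; []; _∷_)
import Data.Vec.Properties as Vec
open import Function using (_∘_)
open import Relation.Binary.Definitions using (DecidableEquality)
open import Relation.Binary.PropositionalEquality
  using (_≡_; _≢_; refl; sym; trans; cong; cong₂; subst; module ≡-Reasoning)
open import Relation.Nullary using (¬_; Dec; yes; no; contradiction)

-- Finite integer sums over lists, and Cauchy-Schwarz.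

private variable
  A A′ A″ : Set

∑ : List A → (A → ℤ) → ℤ
∑ []       f = 0ℤ
∑ (x ∷ xs) f = f x + ∑ xs f

infix 5 ∑
syntax ∑ xs (λ x → t) = ∑[ x ∈ xs ] t

∑-cong : {f g : A → ℤ} (xs : List A) → (∀ x → f x ≡ g x) → ∑ xs f ≡ ∑ xs g
∑-cong []       eq = refl
∑-cong (x ∷ xs) eq = cong₂ _+_ (eq x) (∑-cong xs eq)

∑-+ : (xs : List A) (f g : A → ℤ) → (∑[ x ∈ xs ] f x + g x) ≡ ∑ xs f + ∑ xs g
∑-+ []       f g = refl
∑-+ (x ∷ xs) f g = trans (cong (_+_ (f x + g x)) (∑-+ xs f g)) (lem (f x) (g x) _ _)
  where
  lem : ∀ a b c d → a + b + (c + d) ≡ a + c + (b + d)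
  lem = solve-∀

∑-*ˡ : (xs : List A) (c : ℤ) (f : A → ℤ) → (∑[ x ∈ xs ] c * f x) ≡ c * ∑ xs f
∑-*ˡ []       c f = sym (ℤ.*-zeroʳ c)
∑-*ˡ (x ∷ xs) c f =
  trans (cong (_+_ (c * f x)) (∑-*ˡ xs c f)) (sym (ℤ.*-distribˡ-+ c (f x) _))

∑-*ʳ : (xs : List A) (f : A → ℤ) (c : ℤ) → (∑[ x ∈ xs ] f x * c) ≡ ∑ xs f * c
∑-*ʳ xs f c = begin
  (∑[ x ∈ xs ] f x * c)  ≡⟨ ∑-cong xs (λ x → ℤ.*-comm (f x) c) ⟩
  (∑[ x ∈ xs ] c * f x)  ≡⟨ ∑-*ˡ xs c f ⟩
  c * ∑ xs f             ≡⟨ ℤ.*-comm c _ ⟩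
  ∑ xs f * c             ∎
  where open ≡-Reasoning

∑-linear : (xs : List A) (a b : ℤ) (f g : A → ℤ) →
           (∑[ x ∈ xs ] a * f x + b * g x) ≡ a * ∑ xs f + b * ∑ xs g
∑-linear xs a b f g = trans (∑-+ xs _ _) (cong₂ _+_ (∑-*ˡ xs a f) (∑-*ˡ xs b g))

∑-const : (xs : List A) (c : ℤ) → (∑[ _ ∈ xs ] c) ≡ + length xs * c
∑-const []       c = refl
∑-const (x ∷ xs) c = trans (cong (_+_ c) (∑-const xs c)) (sym (ℤ.suc-* (+ length xs) c))

∑-zero : (xs : List A) → (∑[ _ ∈ xs ] 0ℤ) ≡ 0ℤ
∑-zero xs = trans (∑-const xs 0ℤ) (ℤ.*-zeroʳ (+ length xs))

∑-swap : (xs : List A) (ys : List A′) (f : A → A′ → ℤ) →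
         (∑[ x ∈ xs ] ∑[ y ∈ ys ] f x y) ≡ (∑[ y ∈ ys ] ∑[ x ∈ xs ] f x y)
∑-swap []       ys f = sym (∑-zero ys)
∑-swap (x ∷ xs) ys f = trans (cong (_+_ (∑ ys (f x))) (∑-swap xs ys f)) (sym (∑-+ ys _ _))

∑-* : (xs : List A) (ys : List A′) (f : A → ℤ) (g : A′ → ℤ) →
      ∑ xs f * ∑ ys g ≡ (∑[ x ∈ xs ] ∑[ y ∈ ys ] f x * g y)
∑-* xs ys f g =
  trans (sym (∑-*ʳ xs f (∑ ys g))) (∑-cong xs (λ x → sym (∑-*ˡ ys (f x) g)))

∑-map : (h : A → A′) (xs : List A) (f : A′ → ℤ) → ∑ (map h xs) f ≡ (∑[ x ∈ xs ] f (h x))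
∑-map h []       f = refl
∑-map h (x ∷ xs) f = cong (_+_ (f (h x))) (∑-map h xs f)

∑-++ : (xs ys : List A) (f : A → ℤ) → ∑ (xs ++ ys) f ≡ ∑ xs f + ∑ ys f
∑-++ []       ys f = sym (ℤ.+-identityˡ _)
∑-++ (x ∷ xs) ys f = trans (cong (_+_ (f x)) (∑-++ xs ys f)) (sym (ℤ.+-assoc (f x) _ _))

∑-cartesianProductWith : (h : A → A′ → A″) (xs : List A) (ys : List A′) (f : A″ → ℤ) →
  ∑ (cartesianProductWith h xs ys) f ≡ (∑[ x ∈ xs ] ∑[ y ∈ ys ] f (h x y))
∑-cartesianProductWith h []       ys f = refl
∑-cartesianProductWith h (x ∷ xs) ys f = trans
  (∑-++ (map (h x) ys) _ f)
  (cong₂ _+_ (∑-map (h x) ys f) (∑-cartesianProductWith h xs ys f))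

∑-nonneg : {f : A → ℤ} (xs : List A) → (∀ x → 0ℤ ≤ f x) → 0ℤ ≤ ∑ xs f
∑-nonneg []       f≥0 = ℤ.≤-refl
∑-nonneg (x ∷ xs) f≥0 = ℤ.+-mono-≤ (f≥0 x) (∑-nonneg xs f≥0)

∑-mono : {f g : A → ℤ} (xs : List A) → (∀ x → f x ≤ g x) → ∑ xs f ≤ ∑ xs g
∑-mono []       f≤g = ℤ.≤-refl
∑-mono (x ∷ xs) f≤g = ℤ.+-mono-≤ (f≤g x) (∑-mono xs f≤g)

square-nonneg : ∀ i → 0ℤ ≤ i * i
square-nonneg (+ n)        = subst (0ℤ ≤_) (ℤ.pos-* n n) (ℤ.+≤+ ℕ.z≤n)
square-nonneg (ℤ.-[1+ n ]) = ℤ.+≤+ ℕ.z≤n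

*-nonneg : ∀ {i j} → 0ℤ ≤ i → 0ℤ ≤ j → 0ℤ ≤ i * j
*-nonneg (ℤ.+≤+ {n = m} _) (ℤ.+≤+ {n = n} _) = subst (0ℤ ≤_) (ℤ.pos-* m n) (ℤ.+≤+ ℕ.z≤n)

-- Induction on the list: adding `x` increases the gap `n * t - s * s` by the sum of the squares of
-- `f x - f y` over the tail, so the gap stays nonnegative.
∑-cauchy-schwarz : (xs : List A) (f : A → ℤ) →
                   ∑ xs f * ∑ xs f ≤ + length xs * (∑[ x ∈ xs ] f x * f x)
∑-cauchy-schwarz []       f = ℤ.≤-refl
∑-cauchy-schwarz (x ∷ xs) f = ℤ.0≤i-j⇒j≤i (subst (0ℤ ≤_) eq
  (ℤ.+-mono-≤ (∑-nonneg xs (λ y → square-nonneg (f x - f y)))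
              (ℤ.i≤j⇒0≤j-i (∑-cauchy-schwarz xs f))))
  where
  n = + length xs
  a = f x
  s = ∑ xs f
  t = ∑[ y ∈ xs ] f y * f y
  -- The factors `1ℤ` bring the summand into the shape of `∑-*ˡ` and `∑-linear`.
  expand : ∀ a b → (a - b) * (a - b) ≡ 1ℤ * (a * a) + (1ℤ * (b * b) + (- (a + a)) * b)
  expand = solve-∀
  lem : ∀ n a s t → 1ℤ * (n * (a * a)) + (1ℤ * t + (- (a + a)) * s) + (n * t - s * s)
                  ≡ (1ℤ + n) * (a * a + t) - (a + s) * (a + s)
  lem = solve-∀
  open ≡-Reasoning
  eq : (∑[ y ∈ xs ] (a - f y) * (a - f y)) + (n * t - s * s)
     ≡ + suc (length xs) * (a * a + t) - (a + s) * (a + s)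
  eq = begin
    (∑[ y ∈ xs ] (a - f y) * (a - f y)) + (n * t - s * s)
      ≡⟨ cong (_+ (n * t - s * s)) (begin
           (∑[ y ∈ xs ] (a - f y) * (a - f y))
             ≡⟨ ∑-cong xs (λ y → expand a (f y)) ⟩
           (∑[ y ∈ xs ] 1ℤ * (a * a) + (1ℤ * (f y * f y) + (- (a + a)) * f y))
             ≡⟨ ∑-+ xs _ _ ⟩
           (∑[ y ∈ xs ] 1ℤ * (a * a)) + (∑[ y ∈ xs ] 1ℤ * (f y * f y) + (- (a + a)) * f y)
             ≡⟨ cong₂ _+_ (trans (∑-*ˡ xs 1ℤ _) (cong (1ℤ *_) (∑-const xs (a * a))))
                          (∑-linear xs 1ℤ (- (a + a)) (λ y → f y * f y) f) ⟩
           1ℤ * (n * (a * a)) + (1ℤ * t + (- (a + a)) * s) ∎) ⟩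
    1ℤ * (n * (a * a)) + (1ℤ * t + (- (a + a)) * s) + (n * t - s * s)
      ≡⟨ lem n a s t ⟩
    (1ℤ + n) * (a * a + t) - (a + s) * (a + s) ∎

-- Indicators, and counting in lists without repetition.

⟦_⟧ : Dec A → ℤ
⟦ yes _ ⟧ = 1ℤ
⟦ no  _ ⟧ = 0ℤ

⟦⟧-cong : (a? : Dec A) (b? : Dec A′) → (A → A′) → (A′ → A) → ⟦ a? ⟧ ≡ ⟦ b? ⟧
⟦⟧-cong (yes a) (yes b) f g = refl
⟦⟧-cong (yes a) (no ¬b) f g = contradiction (f a) ¬b
⟦⟧-cong (no ¬a) (yes b) f g = contradiction (g b) ¬a
⟦⟧-cong (no ¬a) (no ¬b) f g = refl

⟦⟧-yes : (a? : Dec A) → A → ⟦ a? ⟧ ≡ 1ℤ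
⟦⟧-yes (yes _) a = refl
⟦⟧-yes (no ¬a) a = contradiction a ¬a

⟦⟧-no : (a? : Dec A) → ¬ A → ⟦ a? ⟧ ≡ 0ℤ
⟦⟧-no (yes a) ¬a = contradiction a ¬a
⟦⟧-no (no _)  ¬a = refl

-- Under an indicator factor a rewrite may assume the condition; this is how identities valid only
-- on the cone or on a hyperplane are used inside sums over all `x`.
⟦⟧-*-cong : (a? : Dec A) {i j : ℤ} → (A → i ≡ j) → ⟦ a? ⟧ * i ≡ ⟦ a? ⟧ * j
⟦⟧-*-cong (yes a) eq = cong (1ℤ *_) (eq a)
⟦⟧-*-cong (no _)  eq = refl

⟦⟧-nonneg : (a? : Dec A) → 0ℤ ≤ ⟦ a? ⟧
⟦⟧-nonneg (yes _) = ℤ.+≤+ ℕ.z≤n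
⟦⟧-nonneg (no _)  = ℤ.≤-refl

length-filter : {P : A → Set} (P? : ∀ x → Dec (P x)) (xs : List A) →
                + length (filter P? xs) ≡ (∑[ x ∈ xs ] ⟦ P? x ⟧)
length-filter P? []       = refl
length-filter P? (x ∷ xs) with P? x
... | yes _ = cong (_+_ 1ℤ) (length-filter P? xs)
... | no  _ = trans (length-filter P? xs) (sym (ℤ.+-identityˡ _))

pos-sum : (f : A → ℕ) (xs : List A) → + sum (map f xs) ≡ (∑[ x ∈ xs ] + f x)
pos-sum f []       = refl
pos-sum f (x ∷ xs) = trans (ℤ.pos-+ (f x) _) (cong (_+_ (+ f x)) (pos-sum f xs))

module _ (_≟_ : DecidableEquality A) where

  ∑-⟦≟⟧-∉ : {a : A} {xs : List A} → All (a ≢_) xs → (∑[ x ∈ xs ] ⟦ x ≟ a ⟧) ≡ 0ℤ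
  ∑-⟦≟⟧-∉ []           = refl
  ∑-⟦≟⟧-∉ {a} {x ∷ _} (a≢x ∷ a≢xs) = cong₂ _+_ (⟦⟧-no (x ≟ a) (a≢x ∘ sym)) (∑-⟦≟⟧-∉ a≢xs)

  ∑-⟦≟⟧-∈ : {a : A} {xs : List A} → Unique xs → a ∈ xs → (∑[ x ∈ xs ] ⟦ x ≟ a ⟧) ≡ 1ℤ
  ∑-⟦≟⟧-∈ {a} (x≢xs ∷ _) (here refl) = cong₂ _+_ (⟦⟧-yes (a ≟ a) refl) (∑-⟦≟⟧-∉ x≢xs)
  ∑-⟦≟⟧-∈ {a} {x ∷ _} (x≢xs ∷ !xs) (there a∈xs) =
    cong₂ _+_ (⟦⟧-no (x ≟ a) (All.lookup x≢xs a∈xs)) (∑-⟦≟⟧-∈ !xs a∈xs)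

  ∑-⟦≟⟧-≤1 : {xs : List A} → Unique xs → (a : A) → (∑[ x ∈ xs ] ⟦ x ≟ a ⟧) ≤ 1ℤ
  ∑-⟦≟⟧-≤1 []           a = ℤ.+≤+ ℕ.z≤n
  ∑-⟦≟⟧-≤1 {x ∷ xs} (x≢xs ∷ !xs) a with x ≟ a
  ... | yes refl = ℤ.≤-reflexive (cong (_+_ 1ℤ) (∑-⟦≟⟧-∉ x≢xs))
  ... | no  _    = subst (_≤ 1ℤ) (sym (ℤ.+-identityˡ _)) (∑-⟦≟⟧-≤1 !xs a)

  ∑-diagonal : {xs : List A} → Unique xs →
               (∑[ x ∈ xs ] ∑[ y ∈ xs ] ⟦ x ≟ y ⟧) ≡ + length xs
  ∑-diagonal {xs} !xs = go !xs (λ a∈ → a∈)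
    where
    -- The outer list becomes a separate `ys` with members in `xs`, so that the induction can shrink
    -- it while the inner sum keeps running over all of `xs`.
    go : {ys : List A} → Unique ys → (∀ {a} → a ∈ ys → a ∈ xs) →
         (∑[ x ∈ ys ] ∑[ y ∈ xs ] ⟦ x ≟ y ⟧) ≡ + length ys
    go {[]}     []        ⊆xs = refl
    go {y ∷ ys} (_ ∷ !ys) ⊆xs = cong₂ _+_
      (trans (∑-cong xs (λ x → ⟦⟧-cong (y ≟ x) (x ≟ y) sym sym))
             (∑-⟦≟⟧-∈ !xs (⊆xs (here refl))))
      (go !ys (⊆xs ∘ there))

-- Sums over a finite type.

record Enumeration (A : Set) : Set where
  field
    elems    : List A
    unique   : Unique elems
    complete : ∀ a → a ∈ elems
    _≟_      : DecidableEquality A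

  total : (A → ℤ) → ℤ
  total = ∑ elems

  total-⟦≟⟧ : (a : A) → (total λ x → ⟦ x ≟ a ⟧) ≡ 1ℤ
  total-⟦≟⟧ a = ∑-⟦≟⟧-∈ _≟_ unique (complete a)

  total-⟦≟⟧-* : (a : A) (f : A → ℤ) → (total λ x → ⟦ x ≟ a ⟧ * f x) ≡ f a
  total-⟦≟⟧-* a f = begin
    (total λ x → ⟦ x ≟ a ⟧ * f x)  ≡⟨ ∑-cong elems (λ x → ⟦⟧-*-cong (x ≟ a) (cong f)) ⟩
    (total λ x → ⟦ x ≟ a ⟧ * f a)  ≡⟨ ∑-*ʳ elems _ (f a) ⟩
    (total λ x → ⟦ x ≟ a ⟧) * f a  ≡⟨ cong (_* f a) (total-⟦≟⟧ a) ⟩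
    1ℤ * f a                       ≡⟨ ℤ.*-identityˡ (f a) ⟩
    f a                            ∎
    where open ≡-Reasoning

  -- Writing `f (φ x)` as a sum of point masses and exchanging the sums leaves, for each `y`, the
  -- size of the fibre of `φ` over `y`; that fibre is the single point `ψ y`.
  total-reindex : (φ ψ : A → A) → (∀ x → ψ (φ x) ≡ x) → (∀ y → φ (ψ y) ≡ y) →
                  (f : A → ℤ) → (total λ x → f (φ x)) ≡ total f
  total-reindex φ ψ ψφ φψ f = begin
    (total λ x → f (φ x))
      ≡⟨ ∑-cong elems (λ x → total-⟦≟⟧-* (φ x) f) ⟨
    (total λ x → total λ y → ⟦ y ≟ φ x ⟧ * f y)
      ≡⟨ ∑-swap elems elems _ ⟩
    (total λ y → total λ x → ⟦ y ≟ φ x ⟧ * f y)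
      ≡⟨ ∑-cong elems (λ y → ∑-*ʳ elems _ (f y)) ⟩
    (total λ y → (total λ x → ⟦ y ≟ φ x ⟧) * f y)
      ≡⟨ ∑-cong elems (λ y → cong (_* f y) (trans
           (∑-cong elems (λ x → ⟦⟧-cong (y ≟ φ x) (x ≟ ψ y)
             (λ { refl → sym (ψφ x) }) (λ { refl → sym (φψ y) })))
           (total-⟦≟⟧ (ψ y)))) ⟩
    (total λ y → 1ℤ * f y)
      ≡⟨ ∑-cong elems (λ y → ℤ.*-identityˡ (f y)) ⟩
    total f ∎
    where open ≡-Reasoning

  -- After exchanging sums, `f y` is weighted by the multiplicity of `y` in `xs`, which is at most
  -- 1. This later enlarges a sum of squares over `P` to the whole space.
  ∑≤total : {xs : List A} → Unique xs → (f : A → ℤ) → (∀ a → 0ℤ ≤ f a) → ∑ xs f ≤ total f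
  ∑≤total {xs} !xs f f≥0 = begin
    ∑ xs f
      ≡⟨ ∑-cong xs (λ x → total-⟦≟⟧-* x f) ⟨
    (∑[ x ∈ xs ] total λ y → ⟦ y ≟ x ⟧ * f y)
      ≡⟨ ∑-swap xs elems _ ⟩
    (total λ y → ∑[ x ∈ xs ] ⟦ y ≟ x ⟧ * f y)
      ≡⟨ ∑-cong elems (λ y → ∑-*ʳ xs _ (f y)) ⟩
    (total λ y → (∑[ x ∈ xs ] ⟦ y ≟ x ⟧) * f y)
      ≤⟨ ∑-mono elems (λ y → ℤ.*-monoʳ-≤-nonNeg (f y) {{ℤ.nonNegative (f≥0 y)}}
           (subst (_≤ 1ℤ)
                  (∑-cong xs (λ x → ⟦⟧-cong (x ≟ y) (y ≟ x) sym sym))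
                  (∑-⟦≟⟧-≤1 _≟_ !xs y))) ⟩
    (total λ y → 1ℤ * f y)
      ≡⟨ ∑-cong elems (λ y → ℤ.*-identityˡ (f y)) ⟩
    total f ∎
    where open ℤ.≤-Reasoning

-- Steps of two match `hyp`, which removes one hyperbolic pair of coordinates at a time; the
-- dimension is `suc m` with `Even m`.
data Even : ℕ → Set where
  zero    : Even 0
  suc-suc : ∀ {m} → Even m → Even (suc (suc m))

2*-even : ∀ k → Even (2 ℕ.* k)
2*-even zero    = zero
2*-even (suc k) = subst Even (sym (ℕ.*-suc 2 k)) (suc-suc (2*-even k))

-- Arithmetic in the finite field.

module _ (K : FiniteField) where
  open FiniteField K
    renaming (_+_ to infixl 6 _⊕_; _*_ to infixl 7 _⊗_; -_ to infix 8 ⊖_; _-_ to infixl 6 _⊝_;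
              _≟_ to infix 4 _≟_)

  R : CommutativeRing _ _
  R = record { isCommutativeRing = isCommutativeRing }

  private module R = CommutativeRing R
  private module RP = RingProperties R.ring
  open SemiringSolver R.commutativeSemiring using (solve; _:=_; con; _:+_; _:*_)

  ⊗-zero-cancel : ∀ {s a} → s ≢ 0# → s ⊗ a ≡ 0# → a ≡ 0#
  ⊗-zero-cancel {s} {a} s≢0 sa≡0 = begin
    a                     ≡⟨ R.*-identityˡ a ⟨
    1# ⊗ a                ≡⟨ cong (_⊗ a) (trans (R.*-comm _ s) (inv-r s s≢0)) ⟨
    inv s s≢0 ⊗ s ⊗ a     ≡⟨ R.*-assoc _ s a ⟩
    inv s s≢0 ⊗ (s ⊗ a)   ≡⟨ cong (inv s s≢0 ⊗_) sa≡0 ⟩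
    inv s s≢0 ⊗ 0#        ≡⟨ R.zeroʳ _ ⟩
    0#                    ∎
    where open ≡-Reasoning

  ⊗-zero-congʳ : ∀ s {a} → a ≡ 0# → s ⊗ a ≡ 0#
  ⊗-zero-congʳ s refl = R.zeroʳ s

  ⊖⊕-cancel : ∀ a b → a ⊕ ⊖ b ⊕ b ≡ a
  ⊖⊕-cancel a b = trans (R.+-assoc a _ b) (trans (cong (a ⊕_) (R.-‿inverseˡ b)) (R.+-identityʳ a))

  ⊝-trans : ∀ a b c → (a ⊝ b) ⊕ (b ⊝ c) ≡ a ⊝ c
  ⊝-trans a b c = trans (sym (R.+-assoc (a ⊝ b) b (⊖ c))) (cong (_⊕ ⊖ c) (⊖⊕-cancel a b))

  ⊝-≡0 : ∀ {a b} → a ⊝ b ≡ 0# → a ≡ b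
  ⊝-≡0 {a} {b} eq = trans (sym (⊖⊕-cancel a b)) (trans (cong (_⊕ b) eq) (R.+-identityˡ b))

  q : ℤ
  q = + order

  1<order : 1 ℕ.< order
  1<order = go elements (elements-complete 0#) (elements-complete 1#)
    where
    go : (xs : List F) → 0# ∈ xs → 1# ∈ xs → 1 ℕ.< length xs
    go (_ ∷ [])    (here p) (here p′) = contradiction (trans p (sym p′)) 0≢1
    go (_ ∷ _ ∷ _) _        _         = ℕ.s≤s (ℕ.s≤s ℕ.z≤n)

  -- `q` is cancelled in `∑∑-e-nonneg` and `hyperplane-size`, and `q - 1ℤ` in `∑∑HQ-bound`; the
  -- latter is positive because 0 and 1 are distinct elements.
  instance
    q>0 : ℤ.Positive q
    q>0 = ℤ.positive (ℤ.+<+ (ℕ.<-trans (ℕ.s≤s ℕ.z≤n) 1<order))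

    q≢0 : ℤ.NonZero q
    q≢0 = ℕ.>-nonZero (ℕ.<-trans (ℕ.s≤s ℕ.z≤n) 1<order)

    q-1>0 : ℤ.Positive (q - 1ℤ)
    q-1>0 = go 1<order
      where
      go : ∀ {n} → 1 ℕ.< n → ℤ.Positive (+ n - 1ℤ)
      go (ℕ.s≤s (ℕ.s≤s _)) = _

  -- Sums over the field and the mean-zero kernel `e`.

  scalars : Enumeration F
  scalars = record
    { elems = elements ; unique = elements-unique ; complete = elements-complete ; _≟_ = _≟_ }

  ∑F : (F → ℤ) → ℤ
  ∑F = ∑ elements

  δ : F → ℤ
  δ a = ⟦ a ≟ 0# ⟧

  -- This is the sum of all nontrivial additive characters at `a`, written with integers only.
  e : F → ℤ
  e a = q * δ a - 1ℤ

  δ-cong : ∀ {a b} → (a ≡ 0# → b ≡ 0#) → (b ≡ 0# → a ≡ 0#) → δ a ≡ δ b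
  δ-cong = ⟦⟧-cong (_ ≟ 0#) (_ ≟ 0#)

  δ-⊗ : ∀ {s} → s ≢ 0# → ∀ a → δ (s ⊗ a) ≡ δ a
  δ-⊗ {s} s≢0 a = δ-cong (⊗-zero-cancel s≢0) (⊗-zero-congʳ s)

  δ-⊕ : ∀ a t → δ (a ⊕ t) ≡ ⟦ t ≟ ⊖ a ⟧
  δ-⊕ a t = ⟦⟧-cong (a ⊕ t ≟ 0#) (t ≟ ⊖ a)
    (λ eq → RP.+-inverseʳ-unique a t eq) (λ { refl → R.-‿inverseʳ a })

  ∑F-δ-⊕ : ∀ a → ∑F (λ t → δ (a ⊕ t)) ≡ 1ℤ
  ∑F-δ-⊕ a = trans (∑-cong elements (δ-⊕ a)) (Enumeration.total-⟦≟⟧ scalars (⊖ a))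

  ∑F-⊗ : ∀ {s} → s ≢ 0# → (f : F → ℤ) → ∑F (λ t → f (s ⊗ t)) ≡ ∑F f
  ∑F-⊗ {s} s≢0 = Enumeration.total-reindex scalars (s ⊗_) (s⁻¹ ⊗_)
    (λ x → cancel s⁻¹ s x (trans (R.*-comm s⁻¹ s) ss⁻¹)) (λ y → cancel s s⁻¹ y ss⁻¹)
    where
    s⁻¹ = inv s s≢0
    ss⁻¹ = inv-r s s≢0
    cancel : ∀ a b x → a ⊗ b ≡ 1# → a ⊗ (b ⊗ x) ≡ x
    cancel a b x ab≡1 =
      trans (sym (R.*-assoc a b x)) (trans (cong (_⊗ x) ab≡1) (R.*-identityˡ x))

  -- The substitution `t` for `s ⊗ t` reduces to slope 1, where the only zero is `⊖ a`.
  ∑F-δ-affine : ∀ {s} → s ≢ 0# → ∀ a → ∑F (λ t → δ (a ⊕ s ⊗ t)) ≡ 1ℤ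
  ∑F-δ-affine s≢0 a = trans (∑F-⊗ s≢0 (λ t → δ (a ⊕ t))) (∑F-δ-⊕ a)

  -- `e` is `q` times a point mass minus the constant 1, hence an evaluation minus a total. A
  -- constant `g` gives `∑F-e`; a translate of `e` gives `∑F-e-e`.
  ∑F-e-* : ∀ a (g : F → ℤ) → ∑F (λ t → e (a ⊕ t) * g t) ≡ q * g (⊖ a) - ∑F g
  ∑F-e-* a g = begin
    ∑F (λ t → e (a ⊕ t) * g t)
      ≡⟨ ∑-cong elements (λ t → trans (cong (λ i → (q * i - 1ℤ) * g t) (δ-⊕ a t)) (expand q _ (g t))) ⟩
    ∑F (λ t → q * (⟦ t ≟ ⊖ a ⟧ * g t) + - 1ℤ * g t)
      ≡⟨ ∑-linear elements q (- 1ℤ) (λ t → ⟦ t ≟ ⊖ a ⟧ * g t) g ⟩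
    q * ∑F (λ t → ⟦ t ≟ ⊖ a ⟧ * g t) + - 1ℤ * ∑F g
      ≡⟨ cong₂ _+_ (cong (q *_) (Enumeration.total-⟦≟⟧-* scalars (⊖ a) g)) (ℤ.-1*i≡-i _) ⟩
    q * g (⊖ a) - ∑F g ∎
    where
    open ≡-Reasoning
    expand : ∀ q d g → (q * d - 1ℤ) * g ≡ q * (d * g) + - 1ℤ * g
    expand = solve-∀

  ∑F-e : ∀ a → ∑F (λ t → e (a ⊕ t)) ≡ 0ℤ
  ∑F-e a = begin
    ∑F (λ t → e (a ⊕ t))       ≡⟨ ∑-cong elements (λ t → ℤ.*-identityʳ _) ⟨
    ∑F (λ t → e (a ⊕ t) * 1ℤ)  ≡⟨ ∑F-e-* a (λ _ → 1ℤ) ⟩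
    q * 1ℤ - ∑F (λ _ → 1ℤ)     ≡⟨ cong (λ i → q * 1ℤ - i) (∑-const elements 1ℤ) ⟩
    q * 1ℤ - q * 1ℤ            ≡⟨ ℤ.+-inverseʳ (q * 1ℤ) ⟩
    0ℤ                         ∎
    where open ≡-Reasoning

  -- The reproducing property of `e`: it exhibits `e (b ⊝ a)` as a Gram matrix up to the factor `q`,
  -- which is the source of positivity.
  ∑F-e-e : ∀ a b → ∑F (λ t → e (a ⊕ t) * e (b ⊕ t)) ≡ q * e (b ⊝ a)
  ∑F-e-e a b = begin
    ∑F (λ t → e (a ⊕ t) * e (b ⊕ t))       ≡⟨ ∑F-e-* a (λ t → e (b ⊕ t)) ⟩
    q * e (b ⊝ a) - ∑F (λ t → e (b ⊕ t))   ≡⟨ cong (λ i → q * e (b ⊝ a) - i) (∑F-e b) ⟩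
    q * e (b ⊝ a) - 0ℤ                     ≡⟨ ℤ.+-identityʳ _ ⟩
    q * e (b ⊝ a)                          ∎
    where open ≡-Reasoning

  -- Up to the factor q, the double sum is the sum of the squares of ∑ e (f y + t) over t.
  ∑∑-e-nonneg : {A : Set} (ys : List A) (f : A → F) →
                0ℤ ≤ (∑[ y ∈ ys ] ∑[ y′ ∈ ys ] e (f y ⊝ f y′))
  ∑∑-e-nonneg ys f = ℤ.*-cancelˡ-≤-pos 0ℤ _ q (begin
    q * 0ℤ
      ≡⟨ ℤ.*-zeroʳ q ⟩
    0ℤ
      ≤⟨ ∑-nonneg elements (λ t → square-nonneg (∑[ y ∈ ys ] e (f y ⊕ t))) ⟩
    ∑F (λ t → (∑[ y ∈ ys ] e (f y ⊕ t)) * (∑[ y ∈ ys ] e (f y ⊕ t)))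
      ≡⟨ ∑-cong elements (λ t → ∑-* ys ys (λ y → e (f y ⊕ t)) (λ y → e (f y ⊕ t))) ⟩
    ∑F (λ t → ∑[ y ∈ ys ] ∑[ y′ ∈ ys ] e (f y ⊕ t) * e (f y′ ⊕ t))
      ≡⟨ ∑-swap elements ys _ ⟩
    (∑[ y ∈ ys ] ∑F (λ t → ∑[ y′ ∈ ys ] e (f y ⊕ t) * e (f y′ ⊕ t)))
      ≡⟨ ∑-cong ys (λ y → ∑-swap elements ys _) ⟩
    (∑[ y ∈ ys ] ∑[ y′ ∈ ys ] ∑F (λ t → e (f y ⊕ t) * e (f y′ ⊕ t)))
      ≡⟨ ∑-cong ys (λ y → ∑-cong ys (λ y′ → ∑F-e-e (f y) (f y′))) ⟩
    (∑[ y ∈ ys ] ∑[ y′ ∈ ys ] q * e (f y′ ⊝ f y))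
      -- `∑F-e-e` produces the difference in the order `f y′ ⊝ f y`, so the two indices trade
      -- places.
      ≡⟨ ∑-swap ys ys _ ⟩
    (∑[ y′ ∈ ys ] ∑[ y ∈ ys ] q * e (f y′ ⊝ f y))
      ≡⟨ ∑-cong ys (λ y′ → ∑-*ˡ ys q _) ⟩
    (∑[ y′ ∈ ys ] q * (∑[ y ∈ ys ] e (f y′ ⊝ f y)))
      ≡⟨ ∑-*ˡ ys q _ ⟩
    q * (∑[ y′ ∈ ys ] ∑[ y ∈ ys ] e (f y′ ⊝ f y)) ∎)
    where open ℤ.≤-Reasoning

  -- Sums over the vector space.

  vecs : ∀ n → List (Vec F n)
  vecs zero    = [] ∷ []
  vecs (suc n) = cartesianProductWith _∷_ elements (vecs n)

  vectors : ∀ n → Enumeration (Vec F n)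
  vectors n = record
    { elems = vecs n ; unique = unique n ; complete = complete ; _≟_ = Vec.≡-dec _≟_ }
    where
    unique : ∀ n → Unique (vecs n)
    unique zero    = [] ∷ []
    unique (suc n) = cartesianProductWith⁺ _∷_ Vec.∷-injective elements-unique (unique n)
    complete : ∀ {n} (v : Vec F n) → v ∈ vecs n
    complete []      = here refl
    complete (a ∷ v) = ∈-cartesianProductWith⁺ _∷_ (elements-complete a) (complete v)

  ∑V : ∀ {n} → (Vec F n → ℤ) → ℤ
  ∑V {n} = ∑ (vecs n)

  ∑V-∷ : ∀ {n} (f : Vec F (suc n) → ℤ) → ∑V f ≡ ∑F (λ a → ∑V (λ v → f (a ∷ v)))
  ∑V-∷ = ∑-cartesianProductWith _∷_ elements (vecs _)

  ∑V-1 : ∀ n → ∑V {n} (λ _ → 1ℤ) ≡ + (order ^ n)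
  ∑V-1 zero    = refl
  ∑V-1 (suc n) = begin
    ∑V {suc n} (λ _ → 1ℤ)             ≡⟨ ∑V-∷ {n} (λ _ → 1ℤ) ⟩
    ∑F (λ a → ∑V {n} (λ _ → 1ℤ))      ≡⟨ ∑-cong elements (λ _ → ∑V-1 n) ⟩
    ∑F (λ a → + (order ^ n))          ≡⟨ ∑-const elements _ ⟩
    q * + (order ^ n)                 ≡⟨ ℤ.pos-* order (order ^ n) ⟨
    + (order ^ suc n)                 ∎
    where open ≡-Reasoning

  infixl 7 _•_
  _•_ : ∀ {n} → F → Vec F n → Vec F n
  s • x = Vec.map (s ⊗_) x

  infixl 6 _+[_]_
  -- One operation, `x` plus `s` times `z`, covers addition, subtraction (`s` equal to `⊖ 1#`) and
  -- the points of a line, so the forms need a single expansion rule each.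
  _+[_]_ : ∀ {n} → Vec F n → F → Vec F n → Vec F n
  x +[ s ] z = Vec.zipWith (λ a b → a ⊕ s ⊗ b) x z

  zeros : ∀ {n} → Vec F n
  zeros = Vec.replicate _ 0#

  vsub-self : ∀ {n} (x : Vec F n) → vsub x x ≡ zeros
  vsub-self []      = refl
  vsub-self (a ∷ x) = cong₂ _∷_ (R.-‿inverseʳ a) (vsub-self x)

  vsub-zeros : ∀ {n} (x y : Vec F n) → vsub x y ≡ zeros → x ≡ y
  vsub-zeros []      []      eq = refl
  vsub-zeros (a ∷ x) (b ∷ y) eq =
    cong₂ _∷_ (⊝-≡0 (Vec.∷-injectiveˡ eq)) (vsub-zeros x y (Vec.∷-injectiveʳ eq))

  vsub-+ : ∀ {n} (x y z : Vec F n) → vsub x y +[ 1# ] vsub y z ≡ vsub x z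
  vsub-+ []      []      []      = refl
  vsub-+ (a ∷ x) (b ∷ y) (c ∷ z) = cong₂ _∷_
    (trans (cong ((a ⊝ b) ⊕_) (R.*-identityˡ _)) (⊝-trans a b c)) (vsub-+ x y z)

  vsub≡+ : ∀ {n} (x y : Vec F n) → vsub x y ≡ x +[ ⊖ 1# ] y
  vsub≡+ []      []      = refl
  vsub≡+ (a ∷ x) (b ∷ y) = cong₂ _∷_ (cong (a ⊕_) (sym (RP.-1*x≈-x b))) (vsub≡+ x y)

  +-cancel : ∀ {n} {s t} (x z : Vec F n) → s ⊕ t ≡ 0# → x +[ s ] z +[ t ] z ≡ x
  +-cancel []      []      _ = refl
  +-cancel {s = s} {t} (a ∷ x) (b ∷ z) s+t≡0 = cong₂ _∷_
    (begin
      a ⊕ s ⊗ b ⊕ t ⊗ b    ≡⟨ solve 4 (λ a s t b → a :+ s :* b :+ t :* b := a :+ (s :+ t) :* b) refl a s t b ⟩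
      a ⊕ (s ⊕ t) ⊗ b      ≡⟨ cong (λ r → a ⊕ r ⊗ b) s+t≡0 ⟩
      a ⊕ 0# ⊗ b           ≡⟨ cong (a ⊕_) (R.zeroˡ b) ⟩
      a ⊕ 0#               ≡⟨ R.+-identityʳ a ⟩
      a                    ∎)
    (+-cancel x z s+t≡0)
    where open ≡-Reasoning

  •-cancel : ∀ {n} {s t} (x : Vec F n) → s ⊗ t ≡ 1# → s • (t • x) ≡ x
  •-cancel []      _ = refl
  •-cancel {s = s} {t} (a ∷ x) st≡1 = cong₂ _∷_
    (trans (sym (R.*-assoc s t a)) (trans (cong (_⊗ a) st≡1) (R.*-identityˡ a)))
    (•-cancel x st≡1)

  -- Averaged over all `s`, this turns a sum over points into a sum over lines in direction `z`, the
  -- device behind `hyperplane-size` and `H-isotropic`.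
  ∑V-translate : ∀ {n} s (z : Vec F n) (f : Vec F n → ℤ) → ∑V (λ x → f (x +[ s ] z)) ≡ ∑V f
  ∑V-translate s z = Enumeration.total-reindex (vectors _) (_+[ s ] z) (_+[ ⊖ s ] z)
    (λ x → +-cancel x z (R.-‿inverseʳ s)) (λ x → +-cancel x z (R.-‿inverseˡ s))

  ∑V-• : ∀ {n} {s} → s ≢ 0# → (f : Vec F n → ℤ) → ∑V (λ x → f (s • x)) ≡ ∑V f
  ∑V-• {s = s} s≢0 = Enumeration.total-reindex (vectors _) (s •_) (inv s s≢0 •_)
    (λ x → •-cancel x (trans (R.*-comm _ s) (inv-r s s≢0))) (λ x → •-cancel x (inv-r s s≢0))

  -- The quadratic form and its polar form.

  module _ (c : F) where

    -- Polar form of Q; in even dimension suc m it is not, because of the junk value at m = 1.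
    B : ∀ {m} → Vec F (suc m) → Vec F (suc m) → F
    B {zero}        (x ∷ [])    (z ∷ [])      = ⊖ c ⊗ (x ⊗ z ⊕ x ⊗ z)
    B {suc zero}    _           _             = 0#
    B {suc (suc m)} (a ∷ b ∷ x) (a′ ∷ b′ ∷ z) = a ⊗ b′ ⊕ b ⊗ a′ ⊕ B x z

    Q : ∀ {m} → Vec F (suc m) → F
    Q = Qform c

    -- `Qform` splits off the last coordinate; this and `Q-∷∷` recast it as a recursion from the
    -- front, parallel to `B`. The sign sits on `c` so that the semiring solver can treat `⊖ c` as
    -- an atom.
    Q-∷[] : ∀ a → Q (a ∷ []) ≡ ⊖ c ⊗ (a ⊗ a)
    Q-∷[] a = trans (R.+-identityˡ _) (RP.-‿distribˡ-* c (a ⊗ a))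

    Q-∷∷ : ∀ {m} a b (x : Vec F (suc m)) → Q (a ∷ b ∷ x) ≡ a ⊗ b ⊕ Q x
    Q-∷∷ a b x = R.+-assoc _ _ _

    Q-+ : ∀ {m} → Even m → (x : Vec F (suc m)) (s : F) (z : Vec F (suc m)) →
          Q (x +[ s ] z) ≡ Q x ⊕ (s ⊗ B x z ⊕ s ⊗ s ⊗ Q z)
    Q-+ zero (x ∷ []) s (z ∷ []) rewrite Q-∷[] (x ⊕ s ⊗ z) | Q-∷[] x | Q-∷[] z =
      solve 4 (λ n x s z → n :* ((x :+ s :* z) :* (x :+ s :* z))
        := n :* (x :* x) :+ (s :* (n :* (x :* z :+ x :* z)) :+ s :* s :* (n :* (z :* z))))
        refl (⊖ c) x s z
    Q-+ (suc-suc ev) (a ∷ b ∷ x) s (a′ ∷ b′ ∷ z)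
      rewrite Q-∷∷ (a ⊕ s ⊗ a′) (b ⊕ s ⊗ b′) (x +[ s ] z) | Q-∷∷ a b x | Q-∷∷ a′ b′ z | Q-+ ev x s z =
      solve 8 (λ a b a′ b′ s Qx Bxz Qz →
        (a :+ s :* a′) :* (b :+ s :* b′) :+ (Qx :+ (s :* Bxz :+ s :* s :* Qz))
        := (a :* b :+ Qx) :+ (s :* (a :* b′ :+ b :* a′ :+ Bxz) :+ s :* s :* (a′ :* b′ :+ Qz)))
        refl a b a′ b′ s (Q x) (B x z) (Q z)

    Q-• : ∀ {m} → Even m → (s : F) (x : Vec F (suc m)) → Q (s • x) ≡ s ⊗ (s ⊗ Q x)
    Q-• zero s (x ∷ []) rewrite Q-∷[] (s ⊗ x) | Q-∷[] x =
      solve 3 (λ n x s → n :* ((s :* x) :* (s :* x)) := s :* (s :* (n :* (x :* x)))) refl (⊖ c) x s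
    Q-• (suc-suc ev) s (a ∷ b ∷ x)
      rewrite Q-∷∷ (s ⊗ a) (s ⊗ b) (s • x) | Q-∷∷ a b x | Q-• ev s x =
      solve 4 (λ a b s Qx → (s :* a) :* (s :* b) :+ s :* (s :* Qx) := s :* (s :* (a :* b :+ Qx)))
        refl a b s (Q x)

    Q-zeros : ∀ {m} → Even m → Q (zeros {suc m}) ≡ 0#
    Q-zeros zero         = trans (Q-∷[] 0#) (⊗-zero-congʳ (⊖ c) (R.zeroˡ 0#))
    Q-zeros (suc-suc {m} ev) = trans (Q-∷∷ {m} 0# 0# zeros)
      (trans (cong₂ _⊕_ (R.zeroˡ 0#) (Q-zeros ev)) (R.+-identityˡ 0#))

    B-+ : ∀ {m} → Even m → (x : Vec F (suc m)) (s : F) (w z : Vec F (suc m)) →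
          B (x +[ s ] w) z ≡ B x z ⊕ s ⊗ B w z
    B-+ zero (x ∷ []) s (w ∷ []) (z ∷ []) =
      solve 5 (λ n x s w z → n :* ((x :+ s :* w) :* z :+ (x :+ s :* w) :* z)
        := n :* (x :* z :+ x :* z) :+ s :* (n :* (w :* z :+ w :* z))) refl (⊖ c) x s w z
    B-+ (suc-suc ev) (a ∷ b ∷ x) s (a′ ∷ b′ ∷ w) (a″ ∷ b″ ∷ z) rewrite B-+ ev x s w z =
      solve 9 (λ a b a′ b′ a″ b″ s Bx Bw →
        (a :+ s :* a′) :* b″ :+ (b :+ s :* b′) :* a″ :+ (Bx :+ s :* Bw)
        := (a :* b″ :+ b :* a″ :+ Bx) :+ s :* (a′ :* b″ :+ b′ :* a″ :+ Bw))
        refl a b a′ b′ a″ b″ s (B x z) (B w z)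

    B-comm : ∀ {m} → Even m → (x z : Vec F (suc m)) → B x z ≡ B z x
    B-comm zero (x ∷ []) (z ∷ []) =
      solve 3 (λ n x z → n :* (x :* z :+ x :* z) := n :* (z :* x :+ z :* x)) refl (⊖ c) x z
    B-comm (suc-suc ev) (a ∷ b ∷ x) (a′ ∷ b′ ∷ z) rewrite B-comm ev x z =
      solve 5 (λ a b a′ b′ r → a :* b′ :+ b :* a′ :+ r := a′ :* b :+ b′ :* a :+ r) refl a b a′ b′ (B z x)

    B-vsub : ∀ {m} → Even m → (x y z : Vec F (suc m)) → B x (vsub y z) ≡ B x y ⊝ B x z
    B-vsub ev x y z = begin
      B x (vsub y z)             ≡⟨ B-comm ev x (vsub y z) ⟩
      B (vsub y z) x             ≡⟨ cong (λ v → B v x) (vsub≡+ y z) ⟩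
      B (y +[ ⊖ 1# ] z) x        ≡⟨ B-+ ev y (⊖ 1#) z x ⟩
      B y x ⊕ ⊖ 1# ⊗ B z x       ≡⟨ cong₂ _⊕_ (B-comm ev y x) (trans (RP.-1*x≈-x _) (cong ⊖_ (B-comm ev z x))) ⟩
      B x y ⊝ B x z              ∎
      where open ≡-Reasoning

    B-• : ∀ {m} → Even m → (s : F) (x z : Vec F (suc m)) → B (s • x) z ≡ s ⊗ B x z
    B-• zero s (x ∷ []) (z ∷ []) =
      solve 4 (λ n s x z → n :* ((s :* x) :* z :+ (s :* x) :* z) := s :* (n :* (x :* z :+ x :* z)))
        refl (⊖ c) s x z
    B-• (suc-suc ev) s (a ∷ b ∷ x) (a′ ∷ b′ ∷ z) rewrite B-• ev s x z =
      solve 6 (λ a b a′ b′ s Bxz → (s :* a) :* b′ :+ (s :* b) :* a′ :+ s :* Bxz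
        := s :* (a :* b′ :+ b :* a′ :+ Bxz)) refl a b a′ b′ s (B x z)

    B-zeros : ∀ {m} → Even m → (z : Vec F (suc m)) → B zeros z ≡ 0#
    B-zeros zero         (z ∷ []) =
      trans (cong (λ r → ⊖ c ⊗ (r ⊕ r)) (R.zeroˡ z)) (⊗-zero-congʳ (⊖ c) (R.+-identityˡ 0#))
    B-zeros (suc-suc ev) (a ∷ b ∷ z) rewrite R.zeroˡ a | R.zeroˡ b | B-zeros ev z =
      trans (R.+-identityʳ _) (R.+-identityˡ 0#)

    B-diag : ∀ {m} → Even m → (z : Vec F (suc m)) → B z z ≡ Q z ⊕ Q z
    B-diag zero (z ∷ []) rewrite Q-∷[] z = R.distribˡ (⊖ c) _ _
    B-diag (suc-suc ev) (a ∷ b ∷ z) rewrite Q-∷∷ a b z | B-diag ev z =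
      solve 3 (λ a b Qz → a :* b :+ b :* a :+ (Qz :+ Qz) := a :* b :+ Qz :+ (a :* b :+ Qz))
        refl a b (Q z)

    -- Isotropic vectors and the size of the cone.

    module _ (c≢0 : c ≢ 0#) where

      -c≢0 : ⊖ c ≢ 0#
      -c≢0 eq = c≢0 (trans (sym (RP.-‿involutive c)) (trans (cong ⊖_ eq) RP.-0#≈0#))

      square-zero : ∀ {a} → ⊖ c ⊗ (a ⊗ a) ≡ 0# → a ≡ 0#
      square-zero {a} eq with a ≟ 0#
      ... | yes a≡0 = a≡0
      ... | no  a≢0 = ⊗-zero-cancel a≢0 (⊗-zero-cancel -c≢0 eq)

      -- An isotropic `z` supported on the last coordinate is zero by `square-zero`. So a nonzero
      -- one has a nonzero entry in some hyperbolic pair, and `w` carries the inverse of that entry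
      -- in the other coordinate of the pair.
      isotropic-partner : ∀ {m} → Even m → (z : Vec F (suc m)) → Q z ≡ 0# → z ≢ zeros →
                          ∃[ w ] B w z ≡ 1#
      isotropic-partner zero (a ∷ []) Qz≡0 z≢0 =
        contradiction (cong (_∷ []) (square-zero (trans (sym (Q-∷[] a)) Qz≡0))) z≢0
      isotropic-partner (suc-suc ev) (a ∷ b ∷ z) Qz≡0 z≢0 with a ≟ 0# | b ≟ 0#
      ... | no a≢0 | _ = 0# ∷ inv a a≢0 ∷ zeros , (begin
        0# ⊗ b ⊕ inv a a≢0 ⊗ a ⊕ B zeros z
          ≡⟨ cong₂ _⊕_ (cong₂ _⊕_ (R.zeroˡ b) (trans (R.*-comm _ a) (inv-r a a≢0))) (B-zeros ev z) ⟩
        0# ⊕ 1# ⊕ 0#  ≡⟨ trans (R.+-identityʳ _) (R.+-identityˡ _) ⟩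
        1#            ∎)
        where open ≡-Reasoning
      ... | yes _ | no b≢0 = inv b b≢0 ∷ 0# ∷ zeros , (begin
        inv b b≢0 ⊗ b ⊕ 0# ⊗ a ⊕ B zeros z
          ≡⟨ cong₂ _⊕_ (cong₂ _⊕_ (trans (R.*-comm _ b) (inv-r b b≢0)) (R.zeroˡ a)) (B-zeros ev z) ⟩
        1# ⊕ 0# ⊕ 0#  ≡⟨ trans (R.+-identityʳ _) (R.+-identityʳ _) ⟩
        1#            ∎)
        where open ≡-Reasoning
      ... | yes refl | yes refl = 0# ∷ 0# ∷ w , (begin
        0# ⊗ 0# ⊕ 0# ⊗ 0# ⊕ B w z
          ≡⟨ cong (_⊕ B w z) (trans (cong₂ _⊕_ (R.zeroˡ 0#) (R.zeroˡ 0#)) (R.+-identityˡ 0#)) ⟩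
        0# ⊕ B w z    ≡⟨ R.+-identityˡ _ ⟩
        B w z         ≡⟨ Bwz≡1 ⟩
        1#            ∎)
        where
        open ≡-Reasoning
        partner : ∃[ w ] B w z ≡ 1#
        partner = isotropic-partner ev z
          (begin
            Q z                ≡⟨ R.+-identityˡ (Q z) ⟨
            0# ⊕ Q z           ≡⟨ cong (_⊕ Q z) (R.zeroˡ 0#) ⟨
            0# ⊗ 0# ⊕ Q z      ≡⟨ Q-∷∷ 0# 0# z ⟨
            Q (0# ∷ 0# ∷ z)    ≡⟨ Qz≡0 ⟩
            0#                 ∎)
          (λ { refl → z≢0 refl })
        w = proj₁ partner
        Bwz≡1 = proj₂ partner

      -- Fix the first coordinate `a` of a hyperbolic pair. If `a` is nonzero, every tail `x`
      -- determines `b`; if `a` is zero, `b` is free and `x` lies on the smaller cone. Both fibres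
      -- have size `order ^ suc m`, so the count is exact, without an error term.
      ∑V-δQ : ∀ {m} → Even m → ∑V {suc m} (λ x → δ (Q x)) ≡ + (order ^ m)
      ∑V-δQ zero = begin
        ∑V (λ x → δ (Q x))
          ≡⟨ ∑V-∷ (λ x → δ (Q x)) ⟩
        ∑F (λ a → δ (Q (a ∷ [])) + 0ℤ)
          ≡⟨ ∑-cong elements (λ a → trans (ℤ.+-identityʳ _) (trans (cong δ (Q-∷[] a))
               (δ-cong square-zero (λ { refl → ⊗-zero-congʳ (⊖ c) (R.zeroˡ 0#) })))) ⟩
        ∑F (λ a → ⟦ a ≟ 0# ⟧)
          ≡⟨ Enumeration.total-⟦≟⟧ scalars 0# ⟩
        1ℤ ∎
        where open ≡-Reasoning
      ∑V-δQ (suc-suc {m} ev) = begin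
        ∑V (λ x → δ (Q x))
          ≡⟨ ∑V-∷ {suc (suc m)} (λ x → δ (Q x)) ⟩
        ∑F (λ a → ∑V {suc (suc m)} (λ x → δ (Q (a ∷ x))))
          ≡⟨ ∑-cong elements (λ a → trans (∑V-∷ {suc m} (λ x → δ (Q (a ∷ x)))) (fibre a)) ⟩
        ∑F (λ a → + (order ^ suc m))
          ≡⟨ ∑-const elements _ ⟩
        q * + (order ^ suc m)
          ≡⟨ ℤ.pos-* order (order ^ suc m) ⟨
        + (order ^ suc (suc m)) ∎
        where
        open ≡-Reasoning
        fibre : ∀ a → ∑F (λ b → ∑V {suc m} (λ x → δ (Q (a ∷ b ∷ x)))) ≡ + (order ^ suc m)
        fibre a with a ≟ 0#
        ... | yes refl = begin
          ∑F (λ b → ∑V {suc m} (λ x → δ (Q (0# ∷ b ∷ x))))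
            ≡⟨ ∑-cong elements (λ b → ∑-cong (vecs (suc m)) (λ x → cong δ
                 (trans (Q-∷∷ 0# b x) (trans (cong (_⊕ Q x) (R.zeroˡ b)) (R.+-identityˡ (Q x)))))) ⟩
          ∑F (λ b → ∑V {suc m} (λ x → δ (Q x)))
            ≡⟨ ∑-cong elements (λ _ → ∑V-δQ ev) ⟩
          ∑F (λ b → + (order ^ m))
            ≡⟨ ∑-const elements _ ⟩
          q * + (order ^ m)
            ≡⟨ ℤ.pos-* order (order ^ m) ⟨
          + (order ^ suc m) ∎
        ... | no a≢0 = begin
          ∑F (λ b → ∑V {suc m} (λ x → δ (Q (a ∷ b ∷ x))))
            ≡⟨ ∑-cong elements (λ b → ∑-cong (vecs (suc m)) (λ x → cong δ
                 (trans (Q-∷∷ a b x) (R.+-comm _ _)))) ⟩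
          ∑F (λ b → ∑V {suc m} (λ x → δ (Q x ⊕ a ⊗ b)))
            ≡⟨ ∑-swap elements (vecs (suc m)) _ ⟩
          ∑V {suc m} (λ x → ∑F (λ b → δ (Q x ⊕ a ⊗ b)))
            ≡⟨ ∑-cong (vecs (suc m)) (λ x → ∑F-δ-affine a≢0 (Q x)) ⟩
          ∑V {suc m} (λ x → 1ℤ)
            ≡⟨ ∑V-1 (suc m) ⟩
          + (order ^ suc m) ∎

      -- Hyperplane sections of the cone.

      module _ {m} (ev : Even m) where

        N : ℤ
        N = + (order ^ m)

        -- By `H-expand` this is `q` times the number of cone points with `B x z ⊕ t` zero, minus
        -- the size `N` of the cone: the deviation of a section from the average.
        H : Vec F (suc m) → F → ℤ
        H z t = ∑V (λ x → δ (Q x) * e (B x z ⊕ t))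

        -- For fixed `x` the argument `B x z ⊕ t` runs through the whole field, where `e` has mean
        -- zero.
        ∑F-H : ∀ z → ∑F (H z) ≡ 0ℤ
        ∑F-H z = begin
          ∑F (λ t → ∑V (λ x → δ (Q x) * e (B x z ⊕ t)))
            ≡⟨ ∑-swap elements (vecs (suc m)) _ ⟩
          ∑V (λ x → ∑F (λ t → δ (Q x) * e (B x z ⊕ t)))
            ≡⟨ ∑-cong (vecs (suc m)) (λ x → trans (∑-*ˡ elements (δ (Q x)) _)
                 (trans (cong (δ (Q x) *_) (∑F-e (B x z))) (ℤ.*-zeroʳ (δ (Q x))))) ⟩
          ∑V {suc m} (λ x → 0ℤ)
            ≡⟨ ∑-zero (vecs (suc m)) ⟩
          0ℤ ∎
          where open ≡-Reasoning

        -- Substituting `t • x` for `x` preserves the cone and turns `B x z ⊕ t` into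
        -- `t ⊗ (B x z ⊕ 1#)`, whose factor `t` does not affect `δ`.
        H-const : ∀ z {t} → t ≢ 0# → H z t ≡ H z 1#
        H-const z {t} t≢0 = begin
          ∑V (λ x → δ (Q x) * e (B x z ⊕ t))
            ≡⟨ ∑V-• t≢0 (λ x → δ (Q x) * e (B x z ⊕ t)) ⟨
          ∑V (λ x → δ (Q (t • x)) * e (B (t • x) z ⊕ t))
            ≡⟨ ∑-cong (vecs (suc m)) (λ x → cong₂ _*_
                 (trans (cong δ (Q-• ev t x)) (trans (δ-⊗ t≢0 _) (δ-⊗ t≢0 _)))
                 (cong (λ i → q * i - 1ℤ) (trans (cong δ (factor x)) (δ-⊗ t≢0 _)))) ⟩
          ∑V (λ x → δ (Q x) * e (B x z ⊕ 1#)) ∎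
          where
          open ≡-Reasoning
          factor : ∀ x → B (t • x) z ⊕ t ≡ t ⊗ (B x z ⊕ 1#)
          factor x = trans (cong (_⊕ t) (B-• ev t x z))
            (solve 2 (λ t b → t :* b :+ t := t :* (b :+ con 1)) refl t (B x z))

        -- The values of `H z` sum to zero, and the `q - 1ℤ` values away from 0 all equal `H z 1#`.
        H-0 : ∀ z → H z 0# ≡ - ((q - 1ℤ) * H z 1#)
        H-0 z = begin
          H z 0#
            ≡⟨ rearrange q (H z 0#) (H z 1#) ⟩
          (H z 0# - H z 1#) * 1ℤ + 1ℤ * (q * H z 1#) + - ((q - 1ℤ) * H z 1#)
            ≡⟨ cong (_+ - ((q - 1ℤ) * H z 1#)) sum≡0 ⟩
          0ℤ + - ((q - 1ℤ) * H z 1#)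
            ≡⟨ ℤ.+-identityˡ _ ⟩
          - ((q - 1ℤ) * H z 1#) ∎
          where
          open ≡-Reasoning
          rearrange : ∀ q a b → a ≡ (a - b) * 1ℤ + 1ℤ * (q * b) + - ((q - 1ℤ) * b)
          rearrange = solve-∀
          d = H z 0# - H z 1#
          -- As a function of `t`, `H z` is a constant plus a point mass of weight `d` at 0.
          interpolate : ∀ t → d * δ t + 1ℤ * H z 1# ≡ H z t
          interpolate t with t ≟ 0#
          ... | yes refl = lem (H z 0#) (H z 1#)
            where
            lem : ∀ a b → (a - b) * 1ℤ + 1ℤ * b ≡ a
            lem = solve-∀
          ... | no t≢0 = trans (lem d (H z 1#)) (sym (H-const z t≢0))
            where
            lem : ∀ a b → a * 0ℤ + 1ℤ * b ≡ b
            lem = solve-∀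
          sum≡0 : d * 1ℤ + 1ℤ * (q * H z 1#) ≡ 0ℤ
          sum≡0 = begin
            d * 1ℤ + 1ℤ * (q * H z 1#)
              ≡⟨ cong₂ (λ i j → d * i + 1ℤ * j)
                   (Enumeration.total-⟦≟⟧ scalars 0#) (∑-const elements (H z 1#)) ⟨
            d * ∑F δ + 1ℤ * ∑F (λ _ → H z 1#)
              ≡⟨ ∑-linear elements d 1ℤ δ (λ _ → H z 1#) ⟨
            ∑F (λ t → d * δ t + 1ℤ * H z 1#)
              ≡⟨ ∑-cong elements interpolate ⟩
            ∑F (H z)
              ≡⟨ ∑F-H z ⟩
            0ℤ ∎

        H-expand : ∀ z t → H z t ≡ q * ∑V (λ x → δ (Q x) * δ (B x z ⊕ t)) - N
        H-expand z t = begin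
          ∑V (λ x → δ (Q x) * e (B x z ⊕ t))
            ≡⟨ ∑-cong (vecs (suc m)) (λ x → expand q (δ (Q x)) _) ⟩
          ∑V (λ x → q * (δ (Q x) * δ (B x z ⊕ t)) + - 1ℤ * δ (Q x))
            ≡⟨ ∑-linear (vecs (suc m)) q (- 1ℤ) (λ x → δ (Q x) * δ (B x z ⊕ t)) (λ x → δ (Q x)) ⟩
          q * ∑V (λ x → δ (Q x) * δ (B x z ⊕ t)) + - 1ℤ * ∑V (λ x → δ (Q x))
            ≡⟨ cong (λ i → q * ∑V (λ x → δ (Q x) * δ (B x z ⊕ t)) + i)
                    (trans (ℤ.-1*i≡-i _) (cong -_ (∑V-δQ ev))) ⟩
          q * ∑V (λ x → δ (Q x) * δ (B x z ⊕ t)) - N ∎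
          where
          open ≡-Reasoning
          expand : ∀ q a b → a * (q * b - 1ℤ) ≡ q * (a * b) + - 1ℤ * a
          expand = solve-∀

        -- Moving `x` by `s` times `w` adds exactly `s` to `B x z`, so each line in direction `w`
        -- meets the hyperplane once; averaging over `s` counts this.
        hyperplane-size : ∀ {w z} → B w z ≡ 1# → ∀ a → ∑V (λ x → δ (B x z ⊕ a)) ≡ N
        hyperplane-size {w} {z} Bwz≡1 a = ℤ.*-cancelˡ-≡ q _ _ (begin
          q * ∑V (λ x → δ (B x z ⊕ a))
            ≡⟨ ∑-const elements _ ⟨
          ∑F (λ s → ∑V (λ x → δ (B x z ⊕ a)))
            ≡⟨ ∑-cong elements (λ s → ∑V-translate s w (λ x → δ (B x z ⊕ a))) ⟨
          ∑F (λ s → ∑V (λ x → δ (B (x +[ s ] w) z ⊕ a)))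
            ≡⟨ ∑-swap elements (vecs (suc m)) _ ⟩
          ∑V (λ x → ∑F (λ s → δ (B (x +[ s ] w) z ⊕ a)))
            ≡⟨ ∑-cong (vecs (suc m)) (λ x → trans
                 (∑-cong elements (λ s → cong δ (shift x s))) (∑F-δ-⊕ (B x z ⊕ a))) ⟩
          ∑V {suc m} (λ _ → 1ℤ)
            ≡⟨ ∑V-1 (suc m) ⟩
          + (order ^ suc m)
            ≡⟨ ℤ.pos-* order (order ^ m) ⟩
          q * N ∎)
          where
          open ≡-Reasoning
          shift : ∀ x s → B (x +[ s ] w) z ⊕ a ≡ B x z ⊕ a ⊕ s
          shift x s = trans
            (cong (_⊕ a) (trans (B-+ ev x s w z) (cong (λ r → B x z ⊕ s ⊗ r) Bwz≡1)))
            (solve 3 (λ b s a → b :+ s :* con 1 :+ a := b :+ a :+ s) refl (B x z) s a)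

        -- For isotropic z, each line parallel to z lying in the hyperplane B x z = -1
        -- meets the cone exactly once.
        H-isotropic : ∀ {z} → Q z ≡ 0# → z ≢ zeros → H z 1# ≡ 0ℤ
        H-isotropic {z} Qz≡0 z≢0 = begin
          H z 1#
            ≡⟨ H-expand z 1# ⟩
          q * ∑V (λ x → δ (Q x) * δ (B x z ⊕ 1#)) - N
            ≡⟨ cong (_- N) count ⟩
          N - N
            ≡⟨ ℤ.+-inverseʳ N ⟩
          0ℤ ∎
          where
          open ≡-Reasoning
          Bzz≡0 : B z z ≡ 0#
          Bzz≡0 = trans (B-diag ev z) (trans (cong₂ _⊕_ Qz≡0 Qz≡0) (R.+-identityˡ 0#))
          Q-line : ∀ x s → Q (x +[ s ] z) ≡ Q x ⊕ B x z ⊗ s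
          Q-line x s = begin
            Q (x +[ s ] z)                           ≡⟨ Q-+ ev x s z ⟩
            Q x ⊕ (s ⊗ B x z ⊕ s ⊗ s ⊗ Q z)          ≡⟨ cong (λ r → Q x ⊕ (s ⊗ B x z ⊕ r)) (⊗-zero-congʳ _ Qz≡0) ⟩
            Q x ⊕ (s ⊗ B x z ⊕ 0#)                   ≡⟨ cong (Q x ⊕_) (trans (R.+-identityʳ _) (R.*-comm s _)) ⟩
            Q x ⊕ B x z ⊗ s                          ∎
          B-line : ∀ x s → B (x +[ s ] z) z ≡ B x z
          B-line x s = begin
            B (x +[ s ] z) z     ≡⟨ B-+ ev x s z z ⟩
            B x z ⊕ s ⊗ B z z    ≡⟨ cong (B x z ⊕_) (⊗-zero-congʳ s Bzz≡0) ⟩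
            B x z ⊕ 0#           ≡⟨ R.+-identityʳ _ ⟩
            B x z                ∎
          Bxz≢0 : ∀ {x} → B x z ⊕ 1# ≡ 0# → B x z ≢ 0#
          Bxz≢0 {x} eq Bxz≡0 =
            0≢1 (trans (sym eq) (trans (cong (_⊕ 1#) Bxz≡0) (R.+-identityˡ 1#)))
          count : q * ∑V (λ x → δ (Q x) * δ (B x z ⊕ 1#)) ≡ N
          count = begin
            q * ∑V (λ x → δ (Q x) * δ (B x z ⊕ 1#))
              ≡⟨ ∑-const elements _ ⟨
            ∑F (λ s → ∑V (λ x → δ (Q x) * δ (B x z ⊕ 1#)))
              ≡⟨ ∑-cong elements (λ s → ∑V-translate s z (λ x → δ (Q x) * δ (B x z ⊕ 1#))) ⟨
            ∑F (λ s → ∑V (λ x → δ (Q (x +[ s ] z)) * δ (B (x +[ s ] z) z ⊕ 1#)))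
              ≡⟨ ∑-swap elements (vecs (suc m)) _ ⟩
            ∑V (λ x → ∑F (λ s → δ (Q (x +[ s ] z)) * δ (B (x +[ s ] z) z ⊕ 1#)))
              ≡⟨ ∑-cong (vecs (suc m)) (λ x → trans
                   (∑-cong elements (λ s → trans
                     (cong₂ _*_ (cong δ (Q-line x s)) (cong (λ b → δ (b ⊕ 1#)) (B-line x s)))
                     (ℤ.*-comm (δ (Q x ⊕ B x z ⊗ s)) _)))
                   (∑-*ˡ elements (δ (B x z ⊕ 1#)) _)) ⟩
            ∑V (λ x → δ (B x z ⊕ 1#) * ∑F (λ s → δ (Q x ⊕ B x z ⊗ s)))
              -- Off the hyperplane the first factor vanishes; on it the slope `B x z` is minus one,
              -- hence nonzero.
              ≡⟨ ∑-cong (vecs (suc m)) (λ x → trans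
                   (⟦⟧-*-cong (B x z ⊕ 1# ≟ 0#) (λ eq → ∑F-δ-affine (Bxz≢0 eq) (Q x)))
                   (ℤ.*-identityʳ _)) ⟩
            ∑V (λ x → δ (B x z ⊕ 1#))
              ≡⟨ hyperplane-size (proj₂ (isotropic-partner ev z Qz≡0 z≢0)) 1# ⟩
            N ∎

        -- Translating by `y` leaves the points `x` and `x + z`. In the first kernel value
        -- `q * δ (Q x) - 1ℤ` the constant contributes nothing because `e ∘ Q` has sum zero, and the
        -- other term restricts to the cone, where `Q (x +[ 1# ] z)` is `B x z ⊕ Q z`.
        correlation : ∀ y y′ → ∑V (λ x → e (Q (vsub x y)) * e (Q (vsub x y′)))
                               ≡ q * H (vsub y y′) (Q (vsub y y′))
        correlation y y′ = begin
          ∑V (λ x → e (Q (vsub x y)) * e (Q (vsub x y′)))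
            ≡⟨ ∑-cong (vecs (suc m)) (λ x → cong₂ (λ u v → e (Q u) * e (Q v))
                 (vsub≡+ x y)
                 (trans (sym (vsub-+ x y y′)) (cong (_+[ 1# ] z) (vsub≡+ x y)))) ⟩
          ∑V (λ x → e (Q (x +[ ⊖ 1# ] y)) * e (Q (x +[ ⊖ 1# ] y +[ 1# ] z)))
            ≡⟨ ∑V-translate (⊖ 1#) y (λ x → e (Q x) * e (Q (x +[ 1# ] z))) ⟩
          ∑V (λ x → e (Q x) * e (Q (x +[ 1# ] z)))
            ≡⟨ ∑-cong (vecs (suc m)) (λ x → expand q (δ (Q x)) (δ (Q (x +[ 1# ] z)))) ⟩
          ∑V (λ x → q * (δ (Q x) * e (Q (x +[ 1# ] z))) + - 1ℤ * e (Q (x +[ 1# ] z)))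
            ≡⟨ ∑-linear (vecs (suc m)) q (- 1ℤ) (λ x → δ (Q x) * e (Q (x +[ 1# ] z)))
                 (λ x → e (Q (x +[ 1# ] z))) ⟩
          q * ∑V (λ x → δ (Q x) * e (Q (x +[ 1# ] z))) + - 1ℤ * ∑V (λ x → e (Q (x +[ 1# ] z)))
            ≡⟨ cong₂ (λ i j → q * i + - 1ℤ * j)
                 (∑-cong (vecs (suc m)) (λ x → ⟦⟧-*-cong (Q x ≟ 0#) (λ Qx≡0 → cong e (on-cone x Qx≡0))))
                 (trans (∑V-translate 1# z (λ x → e (Q x))) ∑V-eQ) ⟩
          q * H z (Q z) + - 1ℤ * 0ℤ
            ≡⟨ trans (cong (_+_ (q * H z (Q z))) (ℤ.*-zeroʳ (- 1ℤ))) (ℤ.+-identityʳ _) ⟩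
          q * H z (Q z) ∎
          where
          open ≡-Reasoning
          z = vsub y y′
          expand : ∀ q a b → (q * a - 1ℤ) * (q * b - 1ℤ) ≡ q * (a * (q * b - 1ℤ)) + - 1ℤ * (q * b - 1ℤ)
          expand = solve-∀
          on-cone : ∀ x → Q x ≡ 0# → Q (x +[ 1# ] z) ≡ B x z ⊕ Q z
          on-cone x Qx≡0 = trans (Q-+ ev x 1# z)
            (trans (cong (_⊕ (1# ⊗ B x z ⊕ 1# ⊗ 1# ⊗ Q z)) Qx≡0)
            (solve 2 (λ b r → con 0 :+ (con 1 :* b :+ con 1 :* con 1 :* r) := b :+ r) refl (B x z) (Q z)))
          -- The cone contains exactly one `q`-th of all points.
          ∑V-eQ : ∑V (λ x → e (Q x)) ≡ 0ℤ
          ∑V-eQ = begin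
            ∑V (λ x → e (Q x))
              ≡⟨ ∑-cong (vecs (suc m)) (λ x → cong (_+_ (q * δ (Q x))) (sym (ℤ.*-identityʳ (- 1ℤ)))) ⟩
            ∑V (λ x → q * δ (Q x) + - 1ℤ * 1ℤ)
              ≡⟨ ∑-linear (vecs (suc m)) q (- 1ℤ) (λ x → δ (Q x)) (λ _ → 1ℤ) ⟩
            q * ∑V (λ x → δ (Q x)) + - 1ℤ * ∑V {suc m} (λ _ → 1ℤ)
              ≡⟨ cong₂ (λ i j → q * i + - 1ℤ * j) (∑V-δQ ev) (trans (∑V-1 (suc m)) (ℤ.pos-* order (order ^ m))) ⟩
            q * N + - 1ℤ * (q * N)
              ≡⟨ cancel (q * N) ⟩
            0ℤ ∎
            where
            cancel : ∀ a → a + - 1ℤ * a ≡ 0ℤ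
            cancel = solve-∀

        -- Positivity and the second moment.

        _≟V_ : DecidableEquality (Vec F (suc m))
        _≟V_ = Enumeration._≟_ (vectors (suc m))

        -- For `z` zero, `H z 0#` is `N * (q - 1ℤ)`. For isotropic nonzero `z` both sides vanish.
        -- Otherwise `H z (Q z)` is `H z 1#`, and `H-0` applies. The gain is that the right side no
        -- longer involves `Q z`, only a kernel in `B x y ⊝ B x y′`.
        defect : ∀ y y′ → (q - 1ℤ) * (q * N * ⟦ y ≟V y′ ⟧ - H (vsub y y′) (Q (vsub y y′)))
                          ≡ H (vsub y y′) 0#
        defect y y′ with y ≟V y′
        ... | yes refl = begin
          (q - 1ℤ) * (q * N * 1ℤ - H z (Q z))
            ≡⟨ cong (λ h → (q - 1ℤ) * (q * N * 1ℤ - h)) (trans (cong (H z) Qz≡0) H≡) ⟩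
          (q - 1ℤ) * (q * N * 1ℤ - N * (q * 1ℤ - 1ℤ))
            ≡⟨ lem q N ⟩
          N * (q * 1ℤ - 1ℤ)
            ≡⟨ H≡ ⟨
          H z 0# ∎
          where
          open ≡-Reasoning
          z = vsub y y
          lem : ∀ q n → (q - 1ℤ) * (q * n * 1ℤ - n * (q * 1ℤ - 1ℤ)) ≡ n * (q * 1ℤ - 1ℤ)
          lem = solve-∀
          Qz≡0 : Q z ≡ 0#
          Qz≡0 = trans (cong Q (vsub-self y)) (Q-zeros ev)
          Bxz≡0 : ∀ x → B x z ⊕ 0# ≡ 0#
          Bxz≡0 x = trans (R.+-identityʳ _) (trans (B-vsub ev x y y) (R.-‿inverseʳ _))
          H≡ : H z 0# ≡ N * (q * 1ℤ - 1ℤ)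
          H≡ = begin
            ∑V (λ x → δ (Q x) * e (B x z ⊕ 0#))
              ≡⟨ ∑-cong (vecs (suc m)) (λ x → cong (λ i → δ (Q x) * (q * i - 1ℤ))
                   (⟦⟧-yes (B x z ⊕ 0# ≟ 0#) (Bxz≡0 x))) ⟩
            ∑V (λ x → δ (Q x) * (q * 1ℤ - 1ℤ))
              ≡⟨ ∑-*ʳ (vecs (suc m)) (λ x → δ (Q x)) _ ⟩
            ∑V (λ x → δ (Q x)) * (q * 1ℤ - 1ℤ)
              ≡⟨ cong (_* (q * 1ℤ - 1ℤ)) (∑V-δQ ev) ⟩
            N * (q * 1ℤ - 1ℤ) ∎
        ... | no y≢y′ with Q (vsub y y′) ≟ 0#
        ...   | yes Qz≡0 = begin
          (q - 1ℤ) * (q * N * 0ℤ - H z (Q z))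
            ≡⟨ cong (λ h → (q - 1ℤ) * (q * N * 0ℤ - h)) (trans (cong (H z) Qz≡0) H≡0) ⟩
          (q - 1ℤ) * (q * N * 0ℤ - 0ℤ)
            ≡⟨ lem q N ⟩
          0ℤ
            ≡⟨ H≡0 ⟨
          H z 0# ∎
          where
          open ≡-Reasoning
          z = vsub y y′
          lem : ∀ q n → (q - 1ℤ) * (q * n * 0ℤ - 0ℤ) ≡ 0ℤ
          lem = solve-∀
          H≡0 : H z 0# ≡ 0ℤ
          H≡0 = trans (H-0 z) (cong -_
            (trans (cong ((q - 1ℤ) *_) (H-isotropic Qz≡0 (y≢y′ ∘ vsub-zeros y y′))) (ℤ.*-zeroʳ (q - 1ℤ))))
        ...   | no Qz≢0 = begin
          (q - 1ℤ) * (q * N * 0ℤ - H z (Q z))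
            ≡⟨ cong (λ h → (q - 1ℤ) * (q * N * 0ℤ - h)) (H-const z Qz≢0) ⟩
          (q - 1ℤ) * (q * N * 0ℤ - H z 1#)
            ≡⟨ lem q N (H z 1#) ⟩
          - ((q - 1ℤ) * H z 1#)
            ≡⟨ H-0 z ⟨
          H z 0# ∎
          where
          open ≡-Reasoning
          z = vsub y y′
          lem : ∀ q n h → (q - 1ℤ) * (q * n * 0ℤ - h) ≡ - ((q - 1ℤ) * h)
          lem = solve-∀

        -- By `B-vsub` each cone point `x` contributes an instance of `∑∑-e-nonneg` with `f` equal
        -- to `B x`.
        ∑∑H0-nonneg : (C : List (Vec F (suc m))) →
                      0ℤ ≤ (∑[ y ∈ C ] ∑[ y′ ∈ C ] H (vsub y y′) 0#)
        ∑∑H0-nonneg C = begin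
          0ℤ
            ≤⟨ ∑-nonneg (vecs (suc m)) (λ x →
                 *-nonneg (⟦⟧-nonneg (Q x ≟ 0#)) (∑∑-e-nonneg C (B x))) ⟩
          ∑V (λ x → δ (Q x) * (∑[ y ∈ C ] ∑[ y′ ∈ C ] e (B x y ⊝ B x y′)))
            ≡⟨ ∑-cong (vecs (suc m)) (λ x → trans (sym (∑-*ˡ C (δ (Q x)) _))
                 (∑-cong C (λ y → trans (sym (∑-*ˡ C (δ (Q x)) _))
                 (∑-cong C (λ y′ → cong (λ a → δ (Q x) * e a)
                   (sym (trans (R.+-identityʳ _) (B-vsub ev x y y′)))))))) ⟩
          ∑V (λ x → ∑[ y ∈ C ] ∑[ y′ ∈ C ] δ (Q x) * e (B x (vsub y y′) ⊕ 0#))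
            ≡⟨ ∑-swap (vecs (suc m)) C _ ⟩
          (∑[ y ∈ C ] ∑V (λ x → ∑[ y′ ∈ C ] δ (Q x) * e (B x (vsub y y′) ⊕ 0#)))
            ≡⟨ ∑-cong C (λ y → ∑-swap (vecs (suc m)) C _) ⟩
          (∑[ y ∈ C ] ∑[ y′ ∈ C ] H (vsub y y′) 0#) ∎
          where open ℤ.≤-Reasoning

        -- Sum `defect` over all pairs of centres: the right side is nonnegative, the indicator
        -- leaves only the diagonal, which counts `length C` for distinct centres, and `q - 1ℤ`
        -- cancels.
        ∑∑HQ-bound : {C : List (Vec F (suc m))} → Unique C →
          (∑[ y ∈ C ] ∑[ y′ ∈ C ] H (vsub y y′) (Q (vsub y y′))) ≤ q * N * + length C
        ∑∑HQ-bound {C} !C = ℤ.0≤i-j⇒j≤i (ℤ.*-cancelˡ-≤-pos 0ℤ _ (q - 1ℤ) (begin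
          (q - 1ℤ) * 0ℤ
            ≡⟨ ℤ.*-zeroʳ (q - 1ℤ) ⟩
          0ℤ
            ≤⟨ ∑∑H0-nonneg C ⟩
          (∑[ y ∈ C ] ∑[ y′ ∈ C ] H (vsub y y′) 0#)
            ≡⟨ ∑-cong C (λ y → ∑-cong C (λ y′ → trans (sym (defect y y′))
                 (expand (q - 1ℤ) (q * N) _ (Φ y y′)))) ⟩
          (∑[ y ∈ C ] ∑[ y′ ∈ C ] a * ⟦ y ≟V y′ ⟧ + b * Φ y y′)
            ≡⟨ ∑-cong C (λ y → ∑-linear C a b (λ y′ → ⟦ y ≟V y′ ⟧) (Φ y)) ⟩
          (∑[ y ∈ C ] a * (∑[ y′ ∈ C ] ⟦ y ≟V y′ ⟧) + b * (∑[ y′ ∈ C ] Φ y y′))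
            ≡⟨ ∑-linear C a b (λ y → ∑[ y′ ∈ C ] ⟦ y ≟V y′ ⟧) (λ y → ∑[ y′ ∈ C ] Φ y y′) ⟩
          a * (∑[ y ∈ C ] ∑[ y′ ∈ C ] ⟦ y ≟V y′ ⟧) + b * (∑[ y ∈ C ] ∑[ y′ ∈ C ] Φ y y′)
            ≡⟨ cong (λ i → a * i + b * (∑[ y ∈ C ] ∑[ y′ ∈ C ] Φ y y′)) (∑-diagonal _≟V_ !C) ⟩
          a * + length C + b * (∑[ y ∈ C ] ∑[ y′ ∈ C ] Φ y y′)
            ≡⟨ expand (q - 1ℤ) (q * N) _ _ ⟨
          (q - 1ℤ) * (q * N * + length C - (∑[ y ∈ C ] ∑[ y′ ∈ C ] Φ y y′)) ∎))
          where
          open ℤ.≤-Reasoning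
          Φ : Vec F (suc m) → Vec F (suc m) → ℤ
          Φ y y′ = H (vsub y y′) (Q (vsub y y′))
          -- `a` and `b` are the coefficients of the indicator and of `Φ` once `defect` is
          -- multiplied out.
          a = (q - 1ℤ) * (q * N)
          b = - (q - 1ℤ)
          expand : ∀ r n i j → r * (n * i - j) ≡ r * n * i + - r * j
          expand = solve-∀

        -- The sum runs over the whole space, not over `P`, so that expanding the square leaves
        -- correlations with an exact value.
        second-moment : {C : List (Vec F (suc m))} → Unique C →
          ∑V (λ x → (∑[ y ∈ C ] e (Q (vsub x y))) * (∑[ y ∈ C ] e (Q (vsub x y))))
            ≤ q * (q * N * + length C)
        second-moment {C} !C = begin
          ∑V (λ x → (∑[ y ∈ C ] e (Q (vsub x y))) * (∑[ y ∈ C ] e (Q (vsub x y))))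
            ≡⟨ ∑-cong (vecs (suc m)) (λ x →
                 ∑-* C C (λ y → e (Q (vsub x y))) (λ y → e (Q (vsub x y)))) ⟩
          ∑V (λ x → ∑[ y ∈ C ] ∑[ y′ ∈ C ] e (Q (vsub x y)) * e (Q (vsub x y′)))
            ≡⟨ ∑-swap (vecs (suc m)) C _ ⟩
          (∑[ y ∈ C ] ∑V (λ x → ∑[ y′ ∈ C ] e (Q (vsub x y)) * e (Q (vsub x y′))))
            ≡⟨ ∑-cong C (λ y → ∑-swap (vecs (suc m)) C _) ⟩
          (∑[ y ∈ C ] ∑[ y′ ∈ C ] ∑V (λ x → e (Q (vsub x y)) * e (Q (vsub x y′))))
            ≡⟨ ∑-cong C (λ y → trans (∑-cong C (correlation y)) (∑-*ˡ C q _)) ⟩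
          (∑[ y ∈ C ] q * (∑[ y′ ∈ C ] H (vsub y y′) (Q (vsub y y′))))
            ≡⟨ ∑-*ˡ C q _ ⟩
          q * (∑[ y ∈ C ] ∑[ y′ ∈ C ] H (vsub y y′) (Q (vsub y y′)))
            ≤⟨ ℤ.*-monoˡ-≤-nonNeg q (∑∑HQ-bound !C) ⟩
          q * (q * N * + length C) ∎
          where open ℤ.≤-Reasoning

        -- Cauchy-Schwarz over `P` contributes `length P`; the remaining squares are nonnegative and
        -- `P` has no repetition, so their sum is at most the second moment.
        discrepancy-bound : {P C : List (Vec F (suc m))} → Unique P → Unique C →
          let D = ∑[ x ∈ P ] ∑[ y ∈ C ] e (Q (vsub x y)) in
          D * D ≤ + length P * (q * (q * N * + length C))
        discrepancy-bound {P} {C} !P !C = begin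
          ∑ P T * ∑ P T
            ≤⟨ ∑-cauchy-schwarz P T ⟩
          + length P * (∑[ x ∈ P ] T x * T x)
            ≤⟨ ℤ.*-monoˡ-≤-nonNeg (+ length P) (ℤ.≤-trans
                 (Enumeration.∑≤total (vectors (suc m)) !P (λ x → T x * T x) (λ x → square-nonneg (T x)))
                 (second-moment !C)) ⟩
          + length P * (q * (q * N * + length C)) ∎
          where
          open ℤ.≤-Reasoning
          T : Vec F (suc m) → ℤ
          T x = ∑[ y ∈ C ] e (Q (vsub x y))

    incidences-discrepancy : ∀ {m} (P C : List (Vec F (suc m))) →
      + (order ℕ.* incidences c P (map (_, 0#) C)) - + (length P ℕ.* length (map (_, 0#) C))
        ≡ (∑[ x ∈ P ] ∑[ y ∈ C ] e (Q (vsub x y)))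
    incidences-discrepancy P C = sym (begin
      (∑[ x ∈ P ] ∑[ y ∈ C ] e (Q (vsub x y)))
        ≡⟨ ∑-cong P (λ x → ∑-linear′ C (λ y → δ (Q (vsub x y)))) ⟩
      (∑[ x ∈ P ] q * (∑[ y ∈ C ] δ (Q (vsub x y))) + - 1ℤ * (∑[ _ ∈ C ] 1ℤ))
        ≡⟨ ∑-linear P q (- 1ℤ) (λ x → ∑[ y ∈ C ] δ (Q (vsub x y))) (λ _ → ∑[ _ ∈ C ] 1ℤ) ⟩
      q * (∑[ x ∈ P ] ∑[ y ∈ C ] δ (Q (vsub x y))) + - 1ℤ * (∑[ _ ∈ P ] ∑[ _ ∈ C ] 1ℤ)
        ≡⟨ cong₂ (λ i j → q * i + j) count size ⟩
      q * + incidences c P S - + (length P ℕ.* length S)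
        ≡⟨ cong (_- + (length P ℕ.* length S)) (ℤ.pos-* order (incidences c P S)) ⟨
      + (order ℕ.* incidences c P S) - + (length P ℕ.* length S) ∎)
      where
      open ≡-Reasoning
      S = map (_, 0#) C
      -- An instance of `∑-linear` with constant second function, as `- 1ℤ * 1ℤ` computes to `- 1ℤ`.
      ∑-linear′ : {A : Set} (xs : List A) (f : A → ℤ) →
                  (∑[ x ∈ xs ] q * f x - 1ℤ) ≡ q * ∑ xs f + - 1ℤ * (∑[ _ ∈ xs ] 1ℤ)
      ∑-linear′ xs f = ∑-linear xs q (- 1ℤ) f (λ _ → 1ℤ)
      count : (∑[ x ∈ P ] ∑[ y ∈ C ] δ (Q (vsub x y))) ≡ + incidences c P S
      count = sym (trans (pos-sum _ P) (∑-cong P (λ x →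
        trans (length-filter (λ s → Q (vsub x (proj₁ s)) ≟ proj₂ s) S) (∑-map (_, 0#) C _))))
      size : - 1ℤ * (∑[ _ ∈ P ] ∑[ _ ∈ C ] 1ℤ) ≡ - (+ (length P ℕ.* length S))
      size = trans (ℤ.-1*i≡-i _) (cong -_ (begin
        (∑[ _ ∈ P ] ∑[ _ ∈ C ] 1ℤ)      ≡⟨ ∑-const P _ ⟩
        + length P * (∑[ _ ∈ C ] 1ℤ)    ≡⟨ cong (+ length P *_) (∑-const C 1ℤ) ⟩
        + length P * (+ length C * 1ℤ)  ≡⟨ cong (+ length P *_) (ℤ.*-identityʳ _) ⟩
        + length P * + length C         ≡⟨ ℤ.pos-* (length P) (length C) ⟨
        + (length P ℕ.* length C)       ≡⟨ cong (λ n → + (length P ℕ.* n)) (length-map (_, 0#) C) ⟨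
        + (length P ℕ.* length S)       ∎))

  -- Reduction to centres and the final inequality.

  zero-radius-spheres : ∀ {n} (S : List (Sphere n)) → All (λ s → proj₂ s ≡ 0#) S →
                        ∃[ C ] S ≡ map (_, 0#) C
  zero-radius-spheres []            []         = [] , refl
  zero-radius-spheres ((y , _) ∷ S) (refl ∷ r≡0) with zero-radius-spheres S r≡0
  ... | C , refl = y ∷ C , refl

-- If `X` equals `Y`, the second alternative holds with difference 0, and its strictness comes from
-- `Y` being positive.
≤⇒<[1+√2]· : ∀ {X Y} → 0 ℕ.< Y → X ℕ.≤ Y → X <[1+√2]· Y
≤⇒<[1+√2]· {X} {Y} 0<Y X≤Y with ℕ.m≤n⇒m<n∨m≡n X≤Y
... | inj₁ X<Y  = inj₁ X<Y
... | inj₂ refl = inj₂ (ℕ.≤-refl , subst (λ d → d ℕ.* d ℕ.< 2 ℕ.* (Y ℕ.* Y)) (sym (ℕ.n∸n≡0 Y)) 0<2Y²)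
  where
  instance
    Y≢0 : ℕ.NonZero Y
    Y≢0 = ℕ.>-nonZero 0<Y
  0<2Y² : 0 ℕ.< 2 ℕ.* (Y ℕ.* Y)
  0<2Y² = ℕ.>-nonZero⁻¹ _ {{ℕ.m*n≢0 2 (Y ℕ.* Y) {{_}} {{ℕ.m*n≢0 Y Y}}}}

+∣i∣*∣i∣ : ∀ i → + (ℤ.∣ i ∣ ℕ.* ℤ.∣ i ∣) ≡ i * i
+∣i∣*∣i∣ (+ n)        = ℤ.pos-* n n
+∣i∣*∣i∣ (ℤ.-[1+ n ]) = refl

length-nonZero : {A : Set} {xs : List A} → xs ≢ [] → ℕ.NonZero (length xs)
length-nonZero {xs = []}    xs≢[] = contradiction refl xs≢[]
length-nonZero {xs = _ ∷ _} xs≢[] = _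

-- The inequality is squared and multiplied by the square of `q`, which clears the division and
-- turns the exponent `d - 1` into `d + 1`. `P` and `S` are nonempty because the strict inequality
-- would otherwise read 0 < 0.
theorem4p2 : (K : FiniteField) → let open FiniteField K in
    order % 2 ≡ 1 →
    (ε : F) → ¬ IsSquare ε →
    (k : ℕ) →
    (c : F) → (c ≡ 1# ⊎ c ≡ ε) →
    (P : List (Vec F (suc (2 ℕ.* k)))) → Unique P → P ≢ [] →
    (S : List (Sphere (suc (2 ℕ.* k)))) → Unique S → S ≢ [] →
    All (λ s → proj₂ s ≡ 0#) S →
    ℤ.∣ (+ (order ℕ.* incidences c P S)) ℤ.- (+ (length P ℕ.* length S)) ∣
    ℕ.* ℤ.∣ (+ (order ℕ.* incidences c P S)) ℤ.- (+ (length P ℕ.* length S)) ∣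
    <[1+√2]· (order ^ (suc (2 ℕ.* k) ℕ.+ 1) ℕ.* length P ℕ.* length S)
theorem4p2 K _ ε ε-nonsquare k c c≡1⊎c≡ε P !P P≢[] S !S S≢[] r≡0
  -- Spheres are traded for their centres `C`; distinctness carries over by `map⁻`.
  with zero-radius-spheres K S r≡0
... | C , refl = ≤⇒<[1+√2]· 0<Y (ℤ.drop‿+≤+ (begin
  + (ℤ.∣ D ∣ ℕ.* ℤ.∣ D ∣)
    ≡⟨ +∣i∣*∣i∣ D ⟩
  D * D
    ≡⟨ cong₂ _*_ (incidences-discrepancy K c P C) (incidences-discrepancy K c P C) ⟩
  _
    ≤⟨ discrepancy-bound K c c≢0 (2*-even k) !P (map⁻ !S) ⟩
  + length P * (+ order * (+ order * + (order ^ m) * + length C))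
    -- One factor `q` comes from `correlation`, one from `∑∑HQ-bound`, and the cone supplies
    -- `order ^ m` with `m` equal to `d - 1`.
    ≡⟨ rearrange (+ length P) (+ order) (+ (order ^ m)) (+ length C) ⟩
  + order * (+ order * + (order ^ m)) * + length P * + length C
    ≡⟨ cong (λ i → + order * i * + length P * + length C) (ℤ.pos-* order (order ^ m)) ⟨
  + order * + (order ^ suc m) * + length P * + length C
    ≡⟨ cong (λ i → i * + length P * + length C) (ℤ.pos-* order (order ^ suc m)) ⟨
  + (order ^ suc (suc m)) * + length P * + length C
    ≡⟨ cong (λ n → + (order ^ n) * + length P * + length C) (ℕ.+-comm 1 (suc m)) ⟩
  + (order ^ (suc m ℕ.+ 1)) * + length P * + length C
    ≡⟨ cong (_* + length C) (ℤ.pos-* (order ^ (suc m ℕ.+ 1)) (length P)) ⟨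
  + (order ^ (suc m ℕ.+ 1) ℕ.* length P) * + length C
    ≡⟨ ℤ.pos-* (order ^ (suc m ℕ.+ 1) ℕ.* length P) (length C) ⟨
  + (order ^ (suc m ℕ.+ 1) ℕ.* length P ℕ.* length C)
    ≡⟨ cong (λ n → + (order ^ (suc m ℕ.+ 1) ℕ.* length P ℕ.* n)) (length-map (_, 0#) C) ⟨
  + (order ^ (suc m ℕ.+ 1) ℕ.* length P ℕ.* length (map (_, 0#) C)) ∎))
  where
  open FiniteField K using (order; 0#; 0≢1; incidences)
  open ℤ.≤-Reasoning
  m = 2 ℕ.* k
  D = + (order ℕ.* incidences c P (map (_, 0#) C)) ℤ.- + (length P ℕ.* length (map (_, 0#) C))
  -- A non-square `ε` is nonzero since 0 is its own square.
  c≢0 : c ≢ 0#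
  c≢0 c≡0 = [ (λ c≡1 → 0≢1 (trans (sym c≡0) c≡1))
            , (λ c≡ε → ε-nonsquare
                (0# , trans (CommutativeRing.zeroʳ (R K) 0#) (trans (sym c≡0) c≡ε)))
            ] c≡1⊎c≡ε
  rearrange : ∀ p q n c → p * (q * (q * n * c)) ≡ q * (q * n) * p * c
  rearrange = solve-∀
  0<Y : 0 ℕ.< order ^ (suc m ℕ.+ 1) ℕ.* length P ℕ.* length (map (_, 0#) C)
  -- `q≢0` speaks of the integer `q` but unfolds to the statement that `order` is nonzero.
  0<Y = ℕ.>-nonZero⁻¹ _ {{ℕ.m*n≢0 _ _
    {{ℕ.m*n≢0 _ _ {{ℕ.m^n≢0 order (suc m ℕ.+ 1) {{q≢0 K}}}} {{length-nonZero P≢[]}}}}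
    {{length-nonZero S≢[]}}}}
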